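{- There is a fixed polynomial $q$ in two variables such that the following holds. Let $\mathbb{F}$ be a field, let $\mathcal{L}\ge 1$, and let $P$ be an $\mathcal{L}$-ordered ABP of size $S$ computing a polynomial $f\in\mathbb{F}[x_1,\ldots,x_n]$. Then there is an $\mathcal{L}$-pass ABP $Q$ of size at most $q(\mathcal{L},S)$ computing $f$.
   Context: Let $X=\{x_1,\ldots,x_n\}$. An algebraic branching program (ABP) over $\mathbb{F}$ is a directed acyclic graph whose vertices are partitioned into layers $L_0,\ldots,L_\ell$, with edges only from $L_i$ to $L_{i+1}$; $L_0=\{s\}$ (source, the one vertex of in-degree 0) and $L_\ell=\{t\}$ (sink, the one vertex of out-degree 0). Each edge is labeled by an element of $X\cup\mathbb{F}$. The size is the number of nodes. The polynomial computed is the sum over all $s$-to-$t$ paths of the product of the edge labels. It is syntactic multilinear (an smABP) if every variable occurs at most once on every $s$-to-$t$ path. For a permutation $\pi$ of $\{1,\ldots,n\}$, an $s$-to-$t$ path $\rho$ is consistent with $\pi$ if whenever $x_i$ and $x_j$ occur as edge labels on $\rho$ with $x_i$ before $x_j$, then $\pi(i)<\pi(j)$. An smABP $P$ is $\mathcal{L}$-ordered if there are $\mathcal{L}$ permutations $\pi_1,\ldots,\pi_{\mathcal{L}}$ such that every $s$-to-$t$ path in $P$ is consistent with $\pi_i$ for some $1\le i\le\mathcal{L}$. An ABP is oblivious if for every layer $L$ there is a variable $x_{i_L}$ such that every edge leaving $L$ is labeled by an element of $\{x_{i_L}\}\cup\mathbb{F}$. An oblivious smABP is read-once oblivious (an ROABP)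 if every variable appears as an edge label in at most one layer. An oblivious smABP with layers $0,\ldots,\ell$ is $\mathcal{L}$-pass if there are layer indices $0=i_1\le i_2\le\cdots\le i_{\mathcal{L}}\le i_{\mathcal{L}+1}=\ell$ such that for every $1\le j\le\mathcal{L}$, the part of the program between layers $i_j$ and $i_{j+1}$ is read-once oblivious, i.e. each variable labels edges of at most one layer in that part. Different passes may read the variables in different orders. -}

module Defs where

open import Level using (Level)
open import Algebra.Bundles using (CommutativeSemiring; CommutativeRing)
open import Algebra.Apartness.Bundles using (HeytingField; HeytingCommutativeRing)
open import Data.Nat as ℕ using (ℕ; zero; suc)
open import Data.Nat.Properties using (+-*-commutativeSemiring)
open import Data.Fin using (Fin; zero; suc; toℕ; inject₁; fromℕ; _<_)
open import Data.Fin.Permutation using (Permutation′; _⟨$⟩ʳ_)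
open import Data.List using (List; []; _∷_; _++_; map; concatMap; foldr; allFin; tabulate; cartesianProductWith)
open import Data.Nat.ListAction using (sum; product)
open import Data.Maybe using (Maybe; just; nothing)
open import Data.Product using (∃; ∃₂; _×_; _,_)
open import Data.Vec using (Vec; []; _∷_; lookup; replicate; zipWith; _[_]≔_; toList)
open import Data.Vec.Properties using (≡-dec)
open import Data.Sum using (_⊎_)
open import Relation.Nullary using (yes; no)
open import Relation.Binary.PropositionalEquality using (_≡_; refl)

private
  variable
    a c ℓ₁ ℓ₂ : Level

-- The exponent vector of a monomial in n variables.
Monomial : ℕ → Set
Monomial n = Vec ℕ n

-- A polynomial is a finite formal sum of terms (coefficient , monomial), in
-- which a monomial may be repeated; two polynomials are equal when all their
-- coefficients agree (_≈ₚ_), not when the lists coincide.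
module Polynomials {c ℓ} (R : CommutativeSemiring c ℓ) (n : ℕ) where
  open CommutativeSemiring R

  Polynomial : Set c
  Polynomial = List (Carrier × Monomial n)

  coeff : Polynomial → Monomial n → Carrier
  coeff []            m = 0#
  coeff ((r , e) ∷ p) m with ≡-dec ℕ._≟_ e m
  ... | yes _ = r + coeff p m
  ... | no  _ = coeff p m

  infix 4 _≈ₚ_
  _≈ₚ_ : Polynomial → Polynomial → Set ℓ
  p ≈ₚ q = ∀ m → coeff p m ≈ coeff q m

  constₚ : Carrier → Polynomial
  constₚ r = (r , replicate n 0) ∷ []

  varₚ : Fin n → Polynomial
  varₚ x = (1# , replicate n 0 [ x ]≔ 1) ∷ []

  infixl 6 _+ₚ_
  infixl 7 _*ₚ_

  _+ₚ_ : Polynomial → Polynomial → Polynomial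
  _+ₚ_ = _++_

  _*ₚ_ : Polynomial → Polynomial → Polynomial
  _*ₚ_ = cartesianProductWith λ { (r , d) (s , e) → r * s , zipWith ℕ._+_ d e }

  sumₚ : List Polynomial → Polynomial
  sumₚ = foldr _+ₚ_ []

  productₚ : List Polynomial → Polynomial
  productₚ = foldr _*ₚ_ (constₚ 1#)

ℕ[_] : ℕ → Set
ℕ[ k ] = Polynomials.Polynomial +-*-commutativeSemiring k

evalℕ : ∀ {k} → ℕ[ k ] → Vec ℕ k → ℕ
evalℕ p xs = sum (map (λ { (r , e) → r ℕ.* product (toList (zipWith ℕ._^_ xs e)) }) p)

fieldSemiring : HeytingField c ℓ₁ ℓ₂ → CommutativeSemiring c ℓ₁
fieldSemiring F = CommutativeRing.commutativeSemiring
  (HeytingCommutativeRing.commutativeRing (HeytingField.heytingCommutativeRing F))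

_[X_] : HeytingField c ℓ₁ ℓ₂ → ℕ → Set c
F [X n ] = Polynomials.Polynomial (fieldSemiring F) n

data Label (A : Set a) (n : ℕ) : Set a where
  var   : Fin n → Label A n
  const : A → Label A n

-- Layers 0 , … , ℓ; layer i has vertex set Fin (width i), and edge i u v is the
-- label of the edge from u in layer i to v in layer i + 1, or nothing if there
-- is no such edge. In particular there are no parallel edges.
record Layered (A : Set a) (n ℓ : ℕ) : Set a where
  field
    width : Fin (suc ℓ) → ℕ
    edge  : (i : Fin ℓ) → Fin (width (inject₁ i)) → Fin (width (suc i)) → Maybe (Label A n)

module _ {A : Set a} {n : ℕ} where
  open Layered

  dropLayer : ∀ {ℓ} → Layered A n (suc ℓ) → Layered A n ℓ
  dropLayer G .width i = width G (suc i)
  dropLayer G .edge  i = edge G (suc i)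

  -- Paths from a vertex of layer 0 to a vertex of the last layer.
  data Path : ∀ {ℓ} (G : Layered A n ℓ) → Fin (width G zero) → Set a where
    end  : ∀ {G : Layered A n 0} {u} → Path G u
    step : ∀ {ℓ} {G : Layered A n (suc ℓ)} {u} (v : Fin (width G (suc zero))) (l : Label A n) →
           edge G zero u v ≡ just l → Path (dropLayer G) v → Path G u

  labels : ∀ {ℓ} {G : Layered A n ℓ} {u} → Path G u → Vec (Label A n) ℓ
  labels end            = []
  labels (step _ l _ ρ) = l ∷ labels ρ

  allPaths : ∀ {ℓ} (G : Layered A n ℓ) u → List (Path G u)
  allPaths {zero}  G u = end ∷ []
  allPaths {suc ℓ} G u = concatMap (λ v → through v (edge G zero u v) refl) (allFin _)
    where
    through : ∀ v (e : Maybe (Label A n)) → edge G zero u v ≡ e → List (Path G u)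
    through v nothing  _  = []
    through v (just l) eq = map (step v l eq) (allPaths (dropLayer G) v)

record ABP (F : HeytingField c ℓ₁ ℓ₂) (n : ℕ) : Set c where
  field
    depth : ℕ
    graph : Layered (HeytingField.Carrier F) n depth
  open Layered graph public
  field
    source        : Fin (width zero)
    source-unique : ∀ u → u ≡ source
    sink          : Fin (width (fromℕ depth))
    sink-unique   : ∀ u → u ≡ sink
    -- By layering the source has in-degree 0 and the sink out-degree 0; these
    -- two fields say that no other vertex does.
    has-in-edge   : ∀ i (v : Fin (width (suc i))) → ∃₂ λ u l → edge i u v ≡ just l
    has-out-edge  : ∀ i (u : Fin (width (inject₁ i))) → ∃₂ λ v l → edge i u v ≡ just l

  -- Paths end in the last layer, whose only vertex is the sink.
  STPath : Set c
  STPath = Path graph source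

module _ {F : HeytingField c ℓ₁ ℓ₂} {n : ℕ} where
  open ABP
  open Polynomials (fieldSemiring F) n

  size : ABP F n → ℕ
  size P = sum (tabulate (width P))

  labelₚ : Label (HeytingField.Carrier F) n → Polynomial
  labelₚ (var x)   = varₚ x
  labelₚ (const r) = constₚ r

  computed : ABP F n → F [X n ]
  computed P = sumₚ (map (λ ρ → productₚ (map labelₚ (toList (labels ρ))))
                         (allPaths (graph P) (source P)))

  infix 4 _Computes_
  _Computes_ : ABP F n → F [X n ] → Set ℓ₁
  P Computes f = computed P ≈ₚ f

  SyntacticMultilinear : ABP F n → Set c
  SyntacticMultilinear P = (ρ : STPath P) → ∀ x p q →
    lookup (labels ρ) p ≡ var x → lookup (labels ρ) q ≡ var x → p ≡ q

  Consistent : (P : ABP F n) → Permutation′ n → STPath P → Set c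
  Consistent P π ρ = ∀ {p q} x y → p < q →
    lookup (labels ρ) p ≡ var x → lookup (labels ρ) q ≡ var y →
    π ⟨$⟩ʳ x < π ⟨$⟩ʳ y

  record Ordered (L : ℕ) (P : ABP F n) : Set c where
    field
      syntacticMultilinear : SyntacticMultilinear P
      order                : Fin L → Permutation′ n
      consistent           : (ρ : STPath P) → ∃ λ i → Consistent P (order i) ρ

  -- The variable assigned to a layer is optional only so that the definition
  -- makes sense for n = 0; for n ≥ 1, nothing can be replaced by any variable.
  Oblivious : ABP F n → Set c
  Oblivious P = ∀ i → ∃ λ (x : Maybe (Fin n)) → ∀ u v l → edge P i u v ≡ just l →
    (∃ λ y → x ≡ just y × l ≡ var y) ⊎ (∃ λ r → l ≡ const r)

  AppearsIn : (P : ABP F n) → Fin n → Fin (depth P) → Set c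
  AppearsIn P x i = ∃₂ λ u v → edge P i u v ≡ just (var x)

  -- The part between layers b and e consists of the edges leaving the layers
  -- b , … , e - 1.
  ReadOnceBetween : (P : ABP F n) → Fin (suc (depth P)) → Fin (suc (depth P)) → Set c
  ReadOnceBetween P b e = ∀ x i j → Between i → Between j → AppearsIn P x i → AppearsIn P x j → i ≡ j
    where
    Between : Fin (depth P) → Set
    Between i = toℕ b ℕ.≤ toℕ i × toℕ i ℕ.< toℕ e

  -- cut j is the layer index i_{j+1}.
  record Pass (L : ℕ) (P : ABP F n) : Set c where
    field
      oblivious            : Oblivious P
      syntacticMultilinear : SyntacticMultilinear P
      cut                  : Fin (suc L) → Fin (suc (depth P))
      cut-first            : cut zero ≡ zero
      cut-last             : cut (fromℕ L) ≡ fromℕ (depth P)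
      cut-mono             : (j : Fin L) → toℕ (cut (inject₁ j)) ℕ.≤ toℕ (cut (suc j))
      readOnce             : (j : Fin L) → ReadOnceBetween P (cut (inject₁ j)) (cut (suc j))

{-# OPTIONS --safe #-}
module Submission where

-- The simulating program reads, for each order in turn, the variables occurring
-- in P in that order, with room for reading constants in between. Its states
-- are the edges of P: a state waits until the letter of its edge is read,
-- traverses the edge at this first opportunity and guesses the next edge. So a
-- path of P is simulated at most once, and it is simulated completely iff its
-- sequence of letters is a subsequence of the schedule, which holds because it
-- is already a subsequence of the pass for the order the path is consistent
-- with. The variables read along a path of the new program are those of a walk
-- in P, and a walk in P extends to a source-to-sink path.

open import Defs
open import Algebra.Apartness.Bundles using (HeytingField)
open import Algebra.Bundles using (CommutativeSemiring)
open import Data.Bool using (Bool; true; false; if_then_else_; _∧_)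
open import Data.Empty using (⊥-elim)
open import Data.Fin as Fin using (Fin; zero; suc; toℕ; inject₁; fromℕ)
open import Data.Fin.Permutation using (Permutation′; _⟨$⟩ʳ_; _⟨$⟩ˡ_; inverseʳ; inverseˡ)
open import Data.Fin.Properties using (suc-injective; toℕ-injective; toℕ<n)
open import Data.List using (List; []; _∷_; _++_; map; concat; concatMap; filter; allFin; tabulate; lookup; length; catMaybes; mapMaybe; replicate)
open import Data.List.Membership.DecPropositional using () renaming (_∈?_ to decMember)
open import Data.List.Membership.Propositional using (_∈_)
open import Data.List.Membership.Propositional.Properties using (∈-∃++; ∈-++⁻; ∈-++⁺ˡ; ∈-++⁺ʳ; ∈-concatMap⁺; ∈-concatMap⁻; ∈-filter⁺; ∈-filter⁻; ∈-lookup; ∈-allFin; ∈-tabulate⁺)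
open import Data.List.Properties using (map-∘; concatMap-++; concatMap-cong; filter-++; filter-all; filter-none; ++-identityʳ; tabulate-lookup; map-tabulate; length-++; length-replicate; length-tabulate; length-mapMaybe)
open import Data.List.Relation.Binary.Sublist.Propositional using (_⊆_; []; _∷_; _∷ʳ_; minimum; ⊆-refl; ⊆-trans)
open import Data.List.Relation.Binary.Sublist.Propositional.Properties using (∷ʳ⁻; ∷⁻; All-resp-⊆) renaming (++⁺ˡ to ⊆-++⁺ˡ; ++⁺ʳ to ⊆-++⁺ʳ)
open import Data.List.Relation.Unary.All as All using (All; []; _∷_)
open import Data.List.Relation.Unary.All.Properties using (++⁺; concat⁺; map⁺)
open import Data.List.Relation.Unary.AllPairs as AllPairs using (AllPairs; []; _∷_)
import Data.List.Relation.Unary.AllPairs.Properties as AllPairs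
open import Data.List.Relation.Unary.Any as Any using (here; there; satisfied)
open import Data.List.Relation.Unary.Unique.Propositional using (Unique)
open import Data.Maybe using (Maybe; just; nothing; maybe)
open import Data.Maybe.Properties using () renaming (≡-dec to maybe-≡-dec)
open import Data.Nat as ℕ using (ℕ; zero; suc; _≤_; _<_; z≤n; s≤s; _+_; _*_)
open import Data.Nat.ListAction using (sum)
open import Data.Nat.Properties using (≤-refl; ≤-reflexive; ≤-trans; <-trans; <-irrefl; <⇒≢; n≤1+n; m≤m+n; m≤n+m; m<n+m; m+[n∸m]≡n; +-suc; +-comm; +-identityʳ; +-cancelˡ-≡; +-mono-≤; +-monoˡ-≤; +-monoʳ-≤; *-comm; *-identityʳ; *-distribʳ-+; *-mono-≤; *-monoˡ-≤; *-monoʳ-≤; module ≤-Reasoning)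
open import Data.Nat.Solver using (module +-*-Solver)
open import Data.Product using (Σ; ∃; ∃₂; _×_; _,_; proj₁; proj₂)
open import Data.Product.Properties using () renaming (≡-dec to ×-≡-dec)
open import Data.Sum using (_⊎_; inj₁; inj₂)
open import Data.Unit using (⊤; tt)
open import Data.Vec as Vec using (Vec; []; _∷_; zipWith; toList)
open import Data.Vec.Properties using (≡-dec)
open import Function using (_∘_; id)
open import Relation.Binary using (Rel; Setoid; Transitive; DecidableEquality)
open import Relation.Binary.PropositionalEquality using (_≡_; _≢_; refl; sym; trans; cong; cong₂; subst; subst₂; module ≡-Reasoning)
import Relation.Binary.Reasoning.Setoid
open import Relation.Nullary using (Dec; yes; no; does; ¬_)
open import Relation.Nullary.Decidable using (dec-true; dec-false)
open import Relation.Unary using (Pred; Decidable)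

-- The obstacle is multiplicity: a word may embed into the schedule in many ways, and a program free
-- to choose when to wait would count its path once per embedding. The greedy embedding is unique
-- and exists whenever any embedding does. Whether to wait must then be determined by the state,
-- which is why a state is an edge and not a vertex: at a vertex, one outgoing edge may have to be
-- taken now while another has to wait. A path may well be read across several passes. This is
-- harmless, since reading once per pass is a property of the schedule alone, and multilinearity is
-- inherited from `P`. The bound must not involve `n`. A pass therefore lists only variables that
-- label edges, at most S² of them because there are no parallel edges. A path has at most as many
-- constants in a row as its depth, hence at most S, which fixes the room between variables.

open Layered

-- Lists

concatMap-tabulate : ∀ {a b} {A : Set a} {B : Set b} {m} (f : A → List B) (g : Fin m → A) →
  concatMap f (tabulate g) ≡ concatMap (f ∘ g) (allFin m)
concatMap-tabulate f g = trans (cong concat (map-tabulate g f)) (cong concat (sym (map-tabulate id (f ∘ g))))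

concatMap-lookup : ∀ {a b} {A : Set a} {B : Set b} (f : A → List B) (xs : List A) →
  concatMap f xs ≡ concatMap (f ∘ lookup xs) (allFin (length xs))
concatMap-lookup f xs = trans (cong (concatMap f) (sym (tabulate-lookup xs))) (concatMap-tabulate f (lookup xs))

concatMap-filter : ∀ {a b p} {A : Set a} {B : Set b} {P : Pred A p} (P? : Decidable P) (f : A → List B) (xs : List A) →
  concatMap f (filter P? xs) ≡ concatMap (λ x → if does (P? x) then f x else []) xs
concatMap-filter P? f []       = refl
concatMap-filter P? f (x ∷ xs) with does (P? x)
... | true  = cong (f x ++_) (concatMap-filter P? f xs)
... | false = concatMap-filter P? f xs

concatMap-only : ∀ {b p} {B : Set b} {m} {P : Pred (Fin m) p} (P? : Decidable P) (f : Fin m → List B) i → P i →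
  (∀ j → P j → j ≡ i) → concatMap (λ j → if does (P? j) then f j else []) (allFin m) ≡ f i
concatMap-only {m = suc m} P? f zero Pi only with P? zero
... | no ¬Pi = ⊥-elim (¬Pi Pi)
... | yes _  = trans (cong (f zero ++_) (trans (concatMap-tabulate {m = m} _ Fin.suc) (none (allFin m)))) (++-identityʳ (f zero))
  where
  none : ∀ js → concatMap (λ j → if does (P? (suc j)) then f (suc j) else []) js ≡ []
  none []       = refl
  none (j ∷ js) with P? (suc j)
  ... | no _   = none js
  ... | yes Pj with () ← only (suc j) Pj
concatMap-only {m = suc m} P? f (suc i) Pi only with P? zero
... | yes P0 with () ← only zero P0
... | no _   = trans (concatMap-tabulate {m = m} _ Fin.suc)
  (concatMap-only (P? ∘ Fin.suc) (f ∘ Fin.suc) i Pi (λ j Pj → suc-injective (only (suc j) Pj)))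

concatMap-concatMap : ∀ {a b c} {A : Set a} {B : Set b} {C : Set c} (g : B → List C) (f : A → List B) xs →
  concatMap g (concatMap f xs) ≡ concatMap (λ x → concatMap g (f x)) xs
concatMap-concatMap g f []       = refl
concatMap-concatMap g f (x ∷ xs) = trans (concatMap-++ g (f x) _) (cong (_ ++_) (concatMap-concatMap g f xs))

filter-concatMap : ∀ {a b p} {A : Set a} {B : Set b} {P : Pred B p} (P? : Decidable P) (f : A → List B) xs →
  filter P? (concatMap f xs) ≡ concatMap (filter P? ∘ f) xs
filter-concatMap P? f []       = refl
filter-concatMap P? f (x ∷ xs) = trans (filter-++ P? (f x) _) (cong (_ ++_) (filter-concatMap P? f xs))

length-concatMap-≤ : ∀ {a b} {A : Set a} {B : Set b} (f : A → List B) {m} → (∀ x → length (f x) ≤ m) →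
  ∀ xs → length (concatMap f xs) ≤ length xs * m
length-concatMap-≤ f h []       = z≤n
length-concatMap-≤ f h (x ∷ xs) = subst (_≤ _) (sym (length-++ (f x))) (+-mono-≤ (h x) (length-concatMap-≤ f h xs))

AllPairs-resp-⊆ : ∀ {a r} {A : Set a} {R : A → A → Set r} {xs ys} → xs ⊆ ys → AllPairs R ys → AllPairs R xs
AllPairs-resp-⊆ []         []       = []
AllPairs-resp-⊆ (_ ∷ʳ s)   (_ ∷ ps) = AllPairs-resp-⊆ s ps
AllPairs-resp-⊆ (refl ∷ s) (p ∷ ps) = All-resp-⊆ s p ∷ AllPairs-resp-⊆ s ps

length-unique-≤ : ∀ {a} {A : Set a} {xs ys : List A} → Unique xs → All (_∈ ys) xs → length xs ≤ length ys
length-unique-≤ []         []             = z≤n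
length-unique-≤ {xs = x ∷ xs} (x∉ ∷ u) (x∈ ∷ xs∈) with as , bs , refl ← ∈-∃++ x∈ = begin
  suc (length xs)              ≤⟨ s≤s (length-unique-≤ u (All.zipWith remove (x∉ , xs∈))) ⟩
  suc (length (as ++ bs))      ≡⟨ cong suc (length-++ as) ⟩
  suc (length as + length bs)  ≡⟨ +-suc (length as) (length bs) ⟨
  length as + suc (length bs)  ≡⟨ length-++ as ⟨
  length (as ++ x ∷ bs)        ∎
  where
  open ≤-Reasoning
  remove : ∀ {z} → x ≢ z × z ∈ as ++ x ∷ bs → z ∈ as ++ bs
  remove (x≢z , z∈) with ∈-++⁻ as z∈
  ... | inj₁ z∈as         = ∈-++⁺ˡ z∈as
  ... | inj₂ (here z≡x)   = ⊥-elim (x≢z (sym z≡x))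
  ... | inj₂ (there z∈bs) = ∈-++⁺ʳ as z∈bs

module _ {a r} {A : Set a} {_≺_ : Rel A r} (irrefl : ∀ {x} → ¬ x ≺ x) (≺-trans : Transitive _≺_) where

  private
    below : ∀ {x y ys} → y ≺ x × x ∈ y ∷ ys → x ∈ ys
    below (y≺x , here refl) = ⊥-elim (irrefl y≺x)
    below (y≺x , there x∈)  = x∈

  sorted⇒⊆ : ∀ {xs ys} → AllPairs _≺_ xs → AllPairs _≺_ ys → All (_∈ ys) xs → xs ⊆ ys
  sorted⇒⊆ []       _        []                = minimum _
  sorted⇒⊆ (p ∷ ps) (q ∷ qs) (here refl ∷ xs∈) = refl ∷ sorted⇒⊆ ps qs (All.zipWith below (p , xs∈))
  sorted⇒⊆ (p ∷ ps) (q ∷ qs) (there x∈ ∷ xs∈) =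
    _ ∷ʳ sorted⇒⊆ (p ∷ ps) qs (x∈ ∷ All.zipWith below (All.map (≺-trans (All.lookup q x∈)) p , xs∈))

-- Concatenations of blocks

module _ {a} {A : Set a} where

  join : ∀ {L} → (Fin L → List A) → List A
  join {zero}  bs = []
  join {suc L} bs = bs zero ++ join (bs ∘ suc)

  ⊆-join : ∀ {L} (bs : Fin L → List A) j → bs j ⊆ join bs
  ⊆-join bs zero    = ⊆-++⁺ʳ (join (bs ∘ suc)) ⊆-refl
  ⊆-join bs (suc j) = ⊆-++⁺ˡ (bs zero) (⊆-join (bs ∘ suc) j)

  length-join : ∀ {L} (bs : Fin L → List A) {m} → (∀ j → length (bs j) ≤ m) → length (join bs) ≤ L * m
  length-join {zero}  bs h = z≤n
  length-join {suc L} bs h = subst (_≤ _) (sym (length-++ (bs zero))) (+-mono-≤ (h zero) (length-join (bs ∘ suc) (h ∘ suc)))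

  -- Recursion on `b` gives the index in the concatenation without casts along `length-++`.
  skip : ∀ (b : List A) {c} → Fin (suc (length c)) → Fin (suc (length (b ++ c)))
  skip []      i = i
  skip (_ ∷ b) i = suc (skip b i)

  toℕ-skip : ∀ (b : List A) {c} (i : Fin (suc (length c))) → toℕ (skip b {c} i) ≡ length b + toℕ i
  toℕ-skip []      i = refl
  toℕ-skip (_ ∷ b) i = cong suc (toℕ-skip b i)

  skip-fromℕ : ∀ (b : List A) {c} → skip b {c} (fromℕ (length c)) ≡ fromℕ (length (b ++ c))
  skip-fromℕ []      = refl
  skip-fromℕ (_ ∷ b) = cong suc (skip-fromℕ b)

  boundary : ∀ {L} (bs : Fin L → List A) → Fin (suc L) → Fin (suc (length (join bs)))
  boundary bs zero            = zero
  boundary {suc L} bs (suc j) = skip (bs zero) (boundary (bs ∘ suc) j)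

  boundary-last : ∀ {L} (bs : Fin L → List A) → boundary bs (fromℕ L) ≡ fromℕ (length (join bs))
  boundary-last {zero}  bs = refl
  boundary-last {suc L} bs = trans (cong (skip (bs zero)) (boundary-last (bs ∘ suc))) (skip-fromℕ (bs zero))

  boundary-mono : ∀ {L} (bs : Fin L → List A) (j : Fin L) → toℕ (boundary bs (inject₁ j)) ≤ toℕ (boundary bs (suc j))
  boundary-mono bs zero    = z≤n
  boundary-mono bs (suc j) = subst₂ _≤_ (sym (toℕ-skip (bs zero) (boundary (bs ∘ suc) (inject₁ j)))) (sym (toℕ-skip (bs zero) (boundary (bs ∘ suc) (suc j))))
    (+-monoʳ-≤ (length (bs zero)) (boundary-mono (bs ∘ suc) j))

  InRange : ∀ {m} → Fin (suc m) → Fin (suc m) → Fin m → Set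
  InRange lo hi i = toℕ lo ≤ toℕ i × toℕ i < toℕ hi

  -- The counterpart of `ReadOnceBetween` for a schedule. It carries over to a program in which each
  -- layer shows no variable but the scheduled one.
  OnceBetween : (τ : List (Maybe A)) (lo hi : Fin (suc (length τ))) → Set a
  OnceBetween τ lo hi = ∀ x i j → InRange lo hi i → InRange lo hi j → lookup τ i ≡ just x → lookup τ j ≡ just x → i ≡ j

module _ {a} {A : Set a} where

  onceBetween-skip : ∀ (b : List (Maybe A)) {c lo hi} → OnceBetween c lo hi → OnceBetween (b ++ c) (skip b lo) (skip b hi)
  onceBetween-skip []      once = once
  onceBetween-skip (_ ∷ b) {c} once x (suc i) (suc j) (s≤s l , s≤s h) (s≤s l′ , s≤s h′) eq eq′ =
    cong suc (onceBetween-skip b {c} once x i j (l , h) (l′ , h′) eq eq′)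

  ∈-catMaybes : ∀ (b : List (Maybe A)) {c x} i → toℕ i < toℕ (skip b {c} zero) → lookup (b ++ c) i ≡ just x → x ∈ catMaybes b
  ∈-catMaybes (just _ ∷ b)  zero    _       refl = here refl
  ∈-catMaybes (just _ ∷ b)  (suc i) (s≤s h) eq   = there (∈-catMaybes b i h eq)
  ∈-catMaybes (nothing ∷ b) (suc i) (s≤s h) eq   = ∈-catMaybes b i h eq

  unique⇒onceBetween : ∀ (b : List (Maybe A)) {c} → Unique (catMaybes b) → OnceBetween (b ++ c) zero (skip b zero)
  unique⇒onceBetween (just _ ∷ b)  u        x zero    zero    _             _              _    _    = refl
  unique⇒onceBetween (nothing ∷ b) u        x zero    zero    _             _              _    _    = refl
  unique⇒onceBetween (just _ ∷ b)  (x∉ ∷ _) x zero    (suc j) _             (_ , s≤s h)    refl eq   = ⊥-elim (All.lookup x∉ (∈-catMaybes b j h eq) refl)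
  unique⇒onceBetween (just _ ∷ b)  (x∉ ∷ _) x (suc i) zero    (_ , s≤s h)   _              eq   refl = ⊥-elim (All.lookup x∉ (∈-catMaybes b i h eq) refl)
  unique⇒onceBetween (just _ ∷ b)  (_ ∷ u)  x (suc i) (suc j) (_ , s≤s h)   (_ , s≤s h′)   eq   eq′  =
    cong suc (unique⇒onceBetween b u x i j (z≤n , h) (z≤n , h′) eq eq′)
  unique⇒onceBetween (nothing ∷ b) u        x (suc i) (suc j) (_ , s≤s h)   (_ , s≤s h′)   eq   eq′  =
    cong suc (unique⇒onceBetween b u x i j (z≤n , h) (z≤n , h′) eq eq′)

  onceBetween-boundaries : ∀ {L} (bs : Fin L → List (Maybe A)) → (∀ j → Unique (catMaybes (bs j))) →
    ∀ j → OnceBetween (join bs) (boundary bs (inject₁ j)) (boundary bs (suc j))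
  onceBetween-boundaries bs u zero    = unique⇒onceBetween (bs zero) (u zero)
  onceBetween-boundaries bs u (suc j) = onceBetween-skip (bs zero) (onceBetween-boundaries (bs ∘ suc) (u ∘ suc) j)

-- Polynomials

module PolynomialProperties {c ℓ} (R : CommutativeSemiring c ℓ) (n : ℕ) where
  open CommutativeSemiring R hiding (+-comm; +-identityʳ; *-comm; *-identityʳ) renaming (_+_ to _⊕_; _*_ to _⊗_; refl to ≈-refl; sym to ≈-sym; trans to ≈-trans)
  open Polynomials R n

  -- A copy of _≈ₚ_ from which both polynomials can be inferred.
  infix 4 _≋_
  record _≋_ (p q : Polynomial) : Set ℓ where
    constructor coeffwise
    field
      coeff≈ : p ≈ₚ q
  open _≋_ public

  ≋-setoid : Setoid c ℓ
  ≋-setoid = record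
    { Carrier       = Polynomial
    ; _≈_           = _≋_
    ; isEquivalence = record
      { refl  = coeffwise λ _ → ≈-refl
      ; sym   = λ e → coeffwise λ m → ≈-sym (coeff≈ e m)
      ; trans = λ e e′ → coeffwise λ m → ≈-trans (coeff≈ e m) (coeff≈ e′ m)
      }
    }

  open Setoid ≋-setoid public using () renaming (refl to ≋-refl; sym to ≋-sym; trans to ≋-trans; reflexive to ≋-reflexive)

  coeff-++ : ∀ p q m → coeff (p ++ q) m ≈ coeff p m ⊕ coeff q m
  coeff-++ []            q m = ≈-sym (+-identityˡ _)
  coeff-++ ((r , e) ∷ p) q m with ≡-dec ℕ._≟_ e m
  ... | yes _ = ≈-trans (+-congˡ (coeff-++ p q m)) (≈-sym (+-assoc _ _ _))
  ... | no  _ = coeff-++ p q m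

  +ₚ-cong : ∀ {p p′ q q′} → p ≋ p′ → q ≋ q′ → p ++ q ≋ p′ ++ q′
  +ₚ-cong {p} {p′} {q} {q′} e e′ = coeffwise λ m →
    ≈-trans (coeff-++ p q m) (≈-trans (+-cong (coeff≈ e m) (coeff≈ e′ m)) (≈-sym (coeff-++ p′ q′ m)))

  concatMap-cong-≋ : ∀ {a} {A : Set a} {f g : A → Polynomial} → (∀ x → f x ≋ g x) →
    ∀ xs → concatMap f xs ≋ concatMap g xs
  concatMap-cong-≋ e []       = ≋-refl
  concatMap-cong-≋ e (x ∷ xs) = +ₚ-cong (e x) (concatMap-cong-≋ e xs)

  zipWith-+-cancelˡ : ∀ {k} (d e e′ : Vec ℕ k) → zipWith _+_ d e ≡ zipWith _+_ d e′ → e ≡ e′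
  zipWith-+-cancelˡ []      []      []        _  = refl
  zipWith-+-cancelˡ (x ∷ d) (y ∷ e) (y′ ∷ e′) eq =
    cong₂ _∷_ (+-cancelˡ-≡ x y y′ (cong Vec.head eq)) (zipWith-+-cancelˡ d e e′ (cong Vec.tail eq))

  -- Divisibility of monomials, which separates the two cases in `term-*-congˡ`.
  subtract? : ∀ {k} (d m : Vec ℕ k) → (∃ λ e → zipWith _+_ d e ≡ m) ⊎ (∀ e → zipWith _+_ d e ≢ m)
  subtract? []      []      = inj₁ ([] , refl)
  subtract? (x ∷ d) (y ∷ m) with x ℕ.≤? y | subtract? d m
  ... | yes x≤y | inj₁ (e , eq) = inj₁ (y ℕ.∸ x ∷ e , cong₂ _∷_ (m+[n∸m]≡n x≤y) eq)
  ... | yes _   | inj₂ ne       = inj₂ λ { (_ ∷ e) eq → ne e (cong Vec.tail eq) }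
  ... | no x≰y  | _             = inj₂ λ { (z ∷ _) eq → x≰y (subst (x ≤_) (cong Vec.head eq) (m≤m+n x z)) }

  module _ (r : Carrier) (d : Monomial n) where

    coeff-term-* : ∀ p e → coeff (((r , d) ∷ []) *ₚ p) (zipWith _+_ d e) ≈ r ⊗ coeff p e
    coeff-term-* []             e = ≈-sym (zeroʳ r)
    coeff-term-* ((s , e′) ∷ p) e with ≡-dec ℕ._≟_ (zipWith _+_ d e′) (zipWith _+_ d e) | ≡-dec ℕ._≟_ e′ e
    ... | yes _  | yes _    = ≈-trans (+-congˡ (coeff-term-* p e)) (≈-sym (distribˡ r s _))
    ... | yes eq | no e′≢e  = ⊥-elim (e′≢e (zipWith-+-cancelˡ d e′ e eq))
    ... | no ne  | yes refl = ⊥-elim (ne refl)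
    ... | no _   | no _     = coeff-term-* p e

    coeff-term-*-∤ : ∀ p {m} → (∀ e → zipWith _+_ d e ≢ m) → coeff (((r , d) ∷ []) *ₚ p) m ≈ 0#
    coeff-term-*-∤ []            ne = ≈-refl
    coeff-term-*-∤ ((s , e) ∷ p) {m} ne with ≡-dec ℕ._≟_ (zipWith _+_ d e) m
    ... | yes eq = ⊥-elim (ne e eq)
    ... | no  _  = coeff-term-*-∤ p ne

    -- Each coefficient of the product comes from a single coefficient of the other factor, or is
    -- zero when `d` does not divide `m`. One term on the left is enough because every label is one
    -- term.
    term-*-congˡ : ∀ {p q} → p ≋ q → ((r , d) ∷ []) *ₚ p ≋ ((r , d) ∷ []) *ₚ q
    term-*-congˡ {p} {q} eq .coeff≈ m with subtract? d m
    ... | inj₁ (e , refl) = ≈-trans (coeff-term-* p e) (≈-trans (*-congˡ (coeff≈ eq e)) (≈-sym (coeff-term-* q e)))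
    ... | inj₂ ne         = ≈-trans (coeff-term-*-∤ p ne) (≈-sym (coeff-term-*-∤ q ne))

  term-*-++ : ∀ t p q → (t ∷ []) *ₚ (p ++ q) ≡ (t ∷ []) *ₚ p ++ (t ∷ []) *ₚ q
  term-*-++ t []      q = refl
  term-*-++ t (x ∷ p) q = cong (_ ∷_) (term-*-++ t p q)

  coeff-const-* : ∀ r p m → coeff (constₚ r *ₚ p) m ≈ r ⊗ coeff p m
  coeff-const-* r p m = subst (λ m′ → coeff (constₚ r *ₚ p) m′ ≈ r ⊗ coeff p m) (0+m m) (coeff-term-* r (Vec.replicate n 0) p m)
    where
    0+m : ∀ {k} (m : Vec ℕ k) → zipWith _+_ (Vec.replicate k 0) m ≡ m
    0+m []      = refl
    0+m (x ∷ m) = cong (x ∷_) (0+m m)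

  const1-* : ∀ p → constₚ 1# *ₚ p ≋ p
  const1-* p .coeff≈ m = ≈-trans (coeff-const-* 1# p m) (*-identityˡ _)

  const0-* : ∀ p → constₚ 0# *ₚ p ≋ []
  const0-* p .coeff≈ m = ≈-trans (coeff-const-* 0# p m) (zeroˡ _)

-- Layered graphs

module _ {a b} {A : Set a} {B : Set b} {n ℓ : ℕ} (h : Vec (Label A n) (suc ℓ) → List B) where

  -- allPaths branches on edge G zero u v together with a proof refl about it,
  -- and its local function cannot be named here, so both have to be abstracted
  -- by the same with. For this the left-hand side of the proof must not be
  -- recognised as the abstracted term: G tt is G x only up to η for ⊤.
  private
    module Branching (G : ⊤ → Layered A n (suc ℓ)) (x : ⊤) (u : Fin (width (G x) zero)) where

      branches : Σ (Fin (width (G x) (suc zero)) → List (Path (G x) u)) λ through →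
                 allPaths (G x) u ≡ concatMap through (allFin _)
      branches = _ , refl

      edge-η : ∀ v → edge (G tt) zero u v ≡ edge (G x) zero u v
      edge-η v = refl

      concatMap-through : ∀ v → concatMap (h ∘ labels) (proj₁ branches v) ≡
        maybe (λ l → concatMap (λ ρ → h (l ∷ labels ρ)) (allPaths (dropLayer (G x)) v)) [] (edge (G x) zero u v)
      concatMap-through v with edge (G x) zero u v | edge-η v
      ... | nothing | _  = refl
      ... | just l  | eq = cong concat (sym (map-∘ (allPaths (dropLayer (G x)) v)))

  concatMap-allPaths : (G : Layered A n (suc ℓ)) (u : Fin (width G zero)) →
    concatMap (h ∘ labels) (allPaths G u) ≡
    concatMap (λ v → maybe (λ l → concatMap (λ ρ → h (l ∷ labels ρ)) (allPaths (dropLayer G) v)) [] (edge G zero u v)) (allFin _)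
  concatMap-allPaths G u = trans (concatMap-concatMap (h ∘ labels) (proj₁ branches) (allFin _)) (concatMap-cong concatMap-through (allFin _))
    where open Branching (λ _ → G) tt u

-- Path sums as a recursion over the layers

module _ {c ℓ₁ ℓ₂} {F : HeytingField c ℓ₁ ℓ₂} {n : ℕ} where
  open CommutativeSemiring (fieldSemiring F) using (Carrier; 0#; 1#)
  open Polynomials (fieldSemiring F) n
  open PolynomialProperties (fieldSemiring F) n

  infixr 7 _▸_
  _▸_ : Label Carrier n → Polynomial → Polynomial
  l ▸ p = labelₚ {F = F} l *ₚ p

  ▸-cong : ∀ l {p q} → p ≋ q → l ▸ p ≋ l ▸ q
  ▸-cong (var _)   = term-*-congˡ _ _
  ▸-cong (const _) = term-*-congˡ _ _

  ▸-++ : ∀ l p q → l ▸ (p ++ q) ≡ l ▸ p ++ l ▸ q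
  ▸-++ (var _)   = term-*-++ _
  ▸-++ (const _) = term-*-++ _

  ▸-[] : ∀ l → l ▸ [] ≡ []
  ▸-[] (var _)   = refl
  ▸-[] (const _) = refl

  ▸-concatMap : ∀ {a} {A : Set a} l (f : A → Polynomial) xs → l ▸ concatMap f xs ≡ concatMap (λ x → l ▸ f x) xs
  ▸-concatMap l f []       = ▸-[] l
  ▸-concatMap l f (x ∷ xs) = trans (▸-++ l (f x) _) (cong (_ ++_) (▸-concatMap l f xs))

  -- The path sum in dynamic programming form, so that programs can be compared layer by layer
  -- without listing paths. No sink is mentioned: the last layer of an `ABP` has only one vertex.
  value : ∀ {ℓ} (G : Layered Carrier n ℓ) → Fin (width G zero) → Polynomial
  value {zero}  G u = constₚ 1#
  value {suc ℓ} G u = concatMap (λ v → maybe (λ l → l ▸ value (dropLayer G) v) [] (edge G zero u v)) (allFin _)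

  pathSum≡value : ∀ {ℓ} (G : Layered Carrier n ℓ) u →
    concatMap (λ ρ → productₚ (map (labelₚ {F = F}) (toList (labels ρ)))) (allPaths G u) ≡ value G u
  pathSum≡value {zero}  G u = refl
  pathSum≡value {suc ℓ} G u =
    trans (concatMap-allPaths product G u) (concatMap-cong (λ v → branch v (edge G zero u v)) (allFin _))
    where
    product : ∀ {ℓ} → Vec (Label Carrier n) ℓ → Polynomial
    product ls = productₚ (map (labelₚ {F = F}) (toList ls))
    branch : ∀ v e →
      maybe (λ l → concatMap (λ ρ → l ▸ product (labels ρ)) (allPaths (dropLayer G) v)) [] e ≡
      maybe (λ l → l ▸ value (dropLayer G) v) [] e
    branch v nothing  = refl
    branch v (just l) = trans (sym (▸-concatMap l (λ ρ → product (labels ρ)) (allPaths (dropLayer G) v)))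
                              (cong (l ▸_) (pathSum≡value (dropLayer G) v))

-- Words, edge lists and walks

module _ {a} {A : Set a} {n : ℕ} where

  -- All constants share the letter nothing.
  letter : Label A n → Maybe (Fin n)
  letter (var x)   = just x
  letter (const _) = nothing

  infixr 5 _▹_
  _▹_ : Label A n → List (Fin n) → List (Fin n)
  var x   ▹ xs = x ∷ xs
  const _ ▹ xs = xs

  word : ∀ {ℓ} {G : Layered A n ℓ} {u} → Path G u → List (Maybe (Fin n))
  word ρ = map letter (toList (labels ρ))

  vars : ∀ {ℓ} → Vec (Label A n) ℓ → List (Fin n)
  vars []       = []
  vars (l ∷ ls) = l ▹ vars ls

_≟ₗ_ : ∀ {n} → DecidableEquality (Maybe (Fin n))
_≟ₗ_ = maybe-≡-dec Fin._≟_

-- Layer index and number within the layer.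
Vertex : Set
Vertex = ℕ × ℕ

_≟ᵥ_ : DecidableEquality Vertex
_≟ᵥ_ = ×-≡-dec ℕ._≟_ ℕ._≟_

-- The endpoints do not depend on a graph, so the edges of all layers have one type and fit into one
-- list.
record Edge {a} (A : Set a) (n : ℕ) : Set a where
  constructor edge⟨_,_,_⟩
  field
    src tgt : Vertex
    label   : Label A n
open Edge

module _ {a} {A : Set a} {n : ℕ} where

  outgoing : List (Edge A n) → Vertex → List (Edge A n)
  outgoing es v = filter (λ e → src e ≟ᵥ v) es

  edgesBetween : ∀ {ℓ} → ℕ → (G : Layered A n (suc ℓ)) → Fin (width G zero) → Fin (width G (suc zero)) → List (Edge A n)
  edgesBetween k G u v = maybe (λ l → edge⟨ (k , toℕ u) , (suc k , toℕ v) , l ⟩ ∷ []) [] (edge G zero u v)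

  edgesFrom : ∀ {ℓ} → ℕ → (G : Layered A n (suc ℓ)) → Fin (width G zero) → List (Edge A n)
  edgesFrom k G u = concatMap (edgesBetween k G u) (allFin _)

  -- k is the index of the first layer of G.
  edges : ∀ {ℓ} → ℕ → Layered A n ℓ → List (Edge A n)
  edges {zero}  k G = []
  edges {suc ℓ} k G = concatMap (edgesFrom k G) (allFin _) ++ edges (suc k) (dropLayer G)

  module _ {ℓ} (k : ℕ) (G : Layered A n (suc ℓ)) where

    ∈-edgesFrom⁻ : ∀ u {e} → e ∈ edgesFrom k G u →
      ∃₂ λ v l → edge G zero u v ≡ just l × e ≡ edge⟨ (k , toℕ u) , (suc k , toℕ v) , l ⟩
    ∈-edgesFrom⁻ u e∈ with v , e∈v ← satisfied (∈-concatMap⁻ (edgesBetween k G u) {xs = allFin _} e∈)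
      with edge G zero u v in eq | e∈v
    ... | just l | here refl = v , l , eq , refl

    src-edgesFrom : ∀ u → All (λ e → src e ≡ (k , toℕ u)) (edgesFrom k G u)
    src-edgesFrom u = All.tabulate λ e∈ → let _ , _ , _ , eq = ∈-edgesFrom⁻ u e∈ in cong src eq

  src-edges : ∀ {ℓ} k (G : Layered A n ℓ) → All (λ e → k ≤ proj₁ (src e)) (edges k G)
  src-edges {zero}  k G = []
  src-edges {suc ℓ} k G = ++⁺
    (concat⁺ (map⁺ (All.universal (λ u → All.map (λ { refl → ≤-refl }) (src-edgesFrom k G u)) (allFin _))))
    (All.map (≤-trans (n≤1+n k)) (src-edges (suc k) (dropLayer G)))

  module _ {ℓ} (k : ℕ) (G : Layered A n (suc ℓ)) where

    outgoing-tail : ∀ v → suc k ≤ proj₁ v → outgoing (edges k G) v ≡ outgoing (edges (suc k) (dropLayer G)) v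
    outgoing-tail v k<v = trans (filter-++ _ (concatMap (edgesFrom k G) (allFin _)) _) (cong (_++ outgoing (edges (suc k) (dropLayer G)) v)
      (filter-none (λ e → src e ≟ᵥ v) (concat⁺ (map⁺ (All.universal
        (λ u → All.map (λ { eq refl → <-irrefl (sym (cong proj₁ eq)) k<v }) (src-edgesFrom k G u)) (allFin _))))))

    -- An equality of lists, so that a sum over outgoing edges can be rewritten as the sum over the
    -- next layer in `value`. Later edges start at a larger layer index, and the other edges of this
    -- layer at a different number.
    outgoing-head : ∀ u → outgoing (edges k G) (k , toℕ u) ≡ edgesFrom k G u
    outgoing-head u = begin
      outgoing (edges k G) v
        ≡⟨ filter-++ P? (concatMap (edgesFrom k G) (allFin _)) _ ⟩
      outgoing (concatMap (edgesFrom k G) (allFin _)) v ++ outgoing (edges (suc k) (dropLayer G)) v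
        ≡⟨ cong₂ _++_ (filter-concatMap P? (edgesFrom k G) (allFin _))
             (filter-none P? (All.map (λ { k<k refl → <-irrefl refl k<k }) (src-edges (suc k) (dropLayer G)))) ⟩
      concatMap (λ u′ → outgoing (edgesFrom k G u′) v) (allFin _) ++ []
        ≡⟨ ++-identityʳ _ ⟩
      concatMap (λ u′ → outgoing (edgesFrom k G u′) v) (allFin _)
        ≡⟨ concatMap-cong only (allFin _) ⟩
      concatMap (λ u′ → if does (u′ Fin.≟ u) then edgesFrom k G u′ else []) (allFin _)
        ≡⟨ concatMap-only (Fin._≟ u) (edgesFrom k G) u refl (λ _ → id) ⟩
      edgesFrom k G u ∎
      where
      open ≡-Reasoning
      v : Vertex
      v = k , toℕ u
      P? : Decidable (λ (e : Edge A n) → src e ≡ v)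
      P? e = src e ≟ᵥ v
      only : ∀ u′ → outgoing (edgesFrom k G u′) v ≡ (if does (u′ Fin.≟ u) then edgesFrom k G u′ else [])
      only u′ with u′ Fin.≟ u
      ... | yes eq = filter-all P? (All.map (λ e → trans e (cong (λ u → k , toℕ u) eq)) (src-edgesFrom k G u′))
      ... | no ne  = filter-none P? (All.map (λ e e′ → ne (toℕ-injective (cong proj₂ (trans (sym e) e′)))) (src-edgesFrom k G u′))

module _ {a} {A : Set a} {n : ℕ} where

  ∈-vars : ∀ {ℓ} (ls : Vec (Label A n) ℓ) p {x} → Vec.lookup ls p ≡ var x → x ∈ vars ls
  ∈-vars (var _ ∷ ls)   zero    refl = here refl
  ∈-vars (var _ ∷ ls)   (suc p) eq   = there (∈-vars ls p eq)
  ∈-vars (const _ ∷ ls) (suc p) eq   = ∈-vars ls p eq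

  unique⇒positions≡ : ∀ {ℓ} (ls : Vec (Label A n) ℓ) → Unique (vars ls) → ∀ x p q →
    Vec.lookup ls p ≡ var x → Vec.lookup ls q ≡ var x → p ≡ q
  unique⇒positions≡ ls             _        x zero    zero    _    _    = refl
  unique⇒positions≡ (var _ ∷ ls)   (x∉ ∷ _) x zero    (suc q) refl eq   = ⊥-elim (All.lookup x∉ (∈-vars ls q eq) refl)
  unique⇒positions≡ (var _ ∷ ls)   (x∉ ∷ _) x (suc p) zero    eq   refl = ⊥-elim (All.lookup x∉ (∈-vars ls p eq) refl)
  unique⇒positions≡ (var _ ∷ ls)   (_ ∷ u)  x (suc p) (suc q) eq   eq′  = cong suc (unique⇒positions≡ ls u x p q eq eq′)
  unique⇒positions≡ (const _ ∷ ls) u        x (suc p) (suc q) eq   eq′  = cong suc (unique⇒positions≡ ls u x p q eq eq′)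

  -- Walks need not end in the last layer.
  data Walk (es : List (Edge A n)) : Vertex → List (Fin n) → Set a where
    []  : ∀ {v} → Walk es v []
    _∷_ : ∀ {e w} → e ∈ es → Walk es (tgt e) w → Walk es (src e) (label e ▹ w)

  ReadsOnly : Maybe (Fin n) → Label A n → Set a
  ReadsOnly b l = (∃ λ y → b ≡ just y × l ≡ var y) ⊎ (∃ λ r → l ≡ const r)

  letter⇒readsOnly : ∀ l {b} → letter l ≡ b → ReadsOnly b l
  letter⇒readsOnly (var x)   refl = inj₁ (x , refl , refl)
  letter⇒readsOnly (const r) eq   = inj₂ (r , refl)

module _ {a r} {A : Set a} {n : ℕ} {_≺_ : Rel (Fin n) r} where

  all-vars : ∀ {p} {P : Fin n → Set p} {ℓ} (ls : Vec (Label A n) ℓ) →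
    (∀ q {y} → Vec.lookup ls q ≡ var y → P y) → All P (vars ls)
  all-vars []             h = []
  all-vars (var x ∷ ls)   h = h zero refl ∷ all-vars ls (h ∘ suc)
  all-vars (const _ ∷ ls) h = all-vars ls (h ∘ suc)

  positions⇒sorted : ∀ {ℓ} (ls : Vec (Label A n) ℓ) →
    (∀ {p q} x y → p Fin.< q → Vec.lookup ls p ≡ var x → Vec.lookup ls q ≡ var y → x ≺ y) →
    AllPairs _≺_ (vars ls)
  positions⇒sorted []             h = []
  positions⇒sorted (var x ∷ ls)   h =
    all-vars ls (λ q eq → h {zero} {suc q} x _ (s≤s z≤n) refl eq) ∷ positions⇒sorted ls (λ x y p<q → h x y (s≤s p<q))
  positions⇒sorted (const _ ∷ ls) h = positions⇒sorted ls (λ x y p<q → h x y (s≤s p<q))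

module _ {a} {A : Set a} {n : ℕ} where

  NoDeadEnds : ∀ {ℓ} → Layered A n ℓ → Set a
  NoDeadEnds G = ∀ i u → ∃₂ λ v l → edge G i u v ≡ just l

  AllEntered : ∀ {ℓ} → Layered A n ℓ → Set a
  AllEntered {ℓ} G = (i : Fin ℓ) (v : Fin (width G (suc i))) → ∃₂ λ u l → edge G i u v ≡ just l

  somePath : ∀ {ℓ} (G : Layered A n ℓ) → NoDeadEnds G → ∀ u → Path G u
  somePath {zero}  G out u = end
  somePath {suc ℓ} G out u = let v , l , eq = out zero u in step v l eq (somePath (dropLayer G) (out ∘ suc) v)

  -- Inductions descend through `dropLayer` while the edge list of the whole program stays fixed.
  -- This is what survives the descent: from layer `k` on, the two have the same outgoing edges.
  AgreesFrom : ∀ {ℓ} → List (Edge A n) → ℕ → Layered A n ℓ → Set a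
  AgreesFrom es k G = ∀ v → k ≤ proj₁ v → outgoing es v ≡ outgoing (edges k G) v

  agreesFrom-dropLayer : ∀ {ℓ} es {k} (G : Layered A n (suc ℓ)) → AgreesFrom es k G → AgreesFrom es (suc k) (dropLayer G)
  agreesFrom-dropLayer es {k} G agrees v k<v = trans (agrees v (≤-trans (n≤1+n k) k<v)) (outgoing-tail k G v k<v)

  ▹-mono-⊆ : ∀ (l : Label A n) {xs ys} → xs ⊆ ys → l ▹ xs ⊆ l ▹ ys
  ▹-mono-⊆ (var x)   s = refl ∷ s
  ▹-mono-⊆ (const _) s = s

  module _ {es : List (Edge A n)} where

    -- Forward extension of a walk: where it stops, `somePath` continues to the last layer and may
    -- read further variables, hence only a sublist. The start is given by an equation because the
    -- index `src e` of a walk cannot be unified with a pair.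
    walk⊆path : ∀ {ℓ} k (G : Layered A n ℓ) → AgreesFrom es k G → NoDeadEnds G →
      ∀ u {v w} → v ≡ (k , toℕ u) → Walk es v w → ∃ λ (ρ : Path G u) → w ⊆ vars (labels ρ)
    walk⊆path k G agrees out u eq [] = somePath G out u , minimum _
    walk⊆path {zero} k G agrees out u eq (e∈ ∷ _)
      with () ← subst (_ ∈_) (agrees (k , toℕ u) ≤-refl) (∈-filter⁺ (λ e → src e ≟ᵥ (k , toℕ u)) e∈ eq)
    walk⊆path {suc ℓ} k G agrees out u eq (e∈ ∷ walk)
      with v , l , edge≡ , refl ← ∈-edgesFrom⁻ k G u (subst (_ ∈_)
             (trans (agrees (k , toℕ u) ≤-refl) (outgoing-head k G u)) (∈-filter⁺ (λ e → src e ≟ᵥ (k , toℕ u)) e∈ eq))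
      with ρ , w⊆ρ ← walk⊆path (suc k) (dropLayer G) (agreesFrom-dropLayer es G agrees) (out ∘ suc) v refl walk
      = step v l edge≡ ρ , ▹-mono-⊆ l w⊆ρ

    -- Backward extension of a walk: the edge `e` locates the layer where it starts, and the
    -- induction descends to that layer. On the way down, a path of `dropLayer G` is prolonged
    -- backwards by an edge from `entered`, so it repeats no variable either.
    walk-unique : ∀ {ℓ} k (G : Layered A n ℓ) → AgreesFrom es k G → NoDeadEnds G → AllEntered G →
      (∀ u (ρ : Path G u) → Unique (vars (labels ρ))) →
      ∀ {v e w} → src e ≡ v → e ∈ edges k G → Walk es v w → Unique w
    walk-unique {suc ℓ} k G agrees out entered unique {e = e} refl e∈ walk
      with ∈-++⁻ (concatMap (edgesFrom k G) (allFin _)) e∈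
    ... | inj₁ e∈head with u , e∈u ← satisfied (∈-concatMap⁻ (edgesFrom k G) {xs = allFin _} e∈head)
                      with ρ , w⊆ρ ← walk⊆path k G agrees out u (All.lookup (src-edgesFrom k G u) e∈u) walk
                      = AllPairs-resp-⊆ w⊆ρ (unique u ρ)
    ... | inj₂ e∈tail = walk-unique (suc k) (dropLayer G) (agreesFrom-dropLayer es G agrees) (out ∘ suc) (entered ∘ suc)
      (λ v ρ → let u , l , eq = entered zero v in tail-unique l (unique u (step v l eq ρ))) refl e∈tail walk
      where
      tail-unique : ∀ (l : Label A n) {xs} → Unique (l ▹ xs) → Unique xs
      tail-unique (var _)   (_ ∷ u) = u
      tail-unique (const _) u       = u

  usedVars : List (Edge A n) → List (Fin n)
  usedVars = mapMaybe (letter ∘ label)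

  ∈-usedVars : ∀ {es : List (Edge A n)} {e x} → e ∈ es → label e ≡ var x → x ∈ usedVars es
  ∈-usedVars {e′ ∷ es} e∈ eq with label e′ in eq′ | e∈
  ... | var y   | here refl with refl ← trans (sym eq) eq′ = here refl
  ... | const _ | here refl with () ← trans (sym eq) eq′
  ... | var y   | there e∈′ = there (∈-usedVars e∈′ eq)
  ... | const _ | there e∈′ = ∈-usedVars e∈′ eq

  ∈-edges⁺ : ∀ {ℓ} k (G : Layered A n (suc ℓ)) u v {l} → edge G zero u v ≡ just l →
    edge⟨ (k , toℕ u) , (suc k , toℕ v) , l ⟩ ∈ edges k G
  ∈-edges⁺ k G u v {l} eq = ∈-++⁺ˡ (∈-concatMap⁺ (edgesFrom k G) (Any.map (λ { refl → ∈-concatMap⁺ (edgesBetween k G u) (Any.map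
    (λ { refl → subst (λ m → e ∈ maybe _ [] m) (sym eq) (here refl) }) (∈-allFin v)) }) (∈-allFin u)))
    where e = edge⟨ (k , toℕ u) , (suc k , toℕ v) , l ⟩

  path-usesVars : ∀ {ℓ} k (G : Layered A n ℓ) {u} (ρ : Path G u) {vs} →
    (∀ {e x} → e ∈ edges k G → label e ≡ var x → x ∈ vs) → All (_∈ vs) (vars (labels ρ))
  path-usesVars k G end                 used = []
  path-usesVars k G {u} (step v l eq ρ) used with l
  ... | var x   = used (∈-edges⁺ k G u v eq) refl ∷ path-usesVars (suc k) (dropLayer G) ρ (used ∘ ∈-++⁺ʳ _)
  ... | const _ = path-usesVars (suc k) (dropLayer G) ρ (used ∘ ∈-++⁺ʳ _)

-- Counting edges and layers

module _ {a} {A : Set a} {n : ℕ} where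

  vertices : ∀ {ℓ} → Layered A n ℓ → ℕ
  vertices G = sum (tabulate (width G))

  length-edgesFrom : ∀ {ℓ} k (G : Layered A n (suc ℓ)) u → length (edgesFrom k G u) ≤ width G (suc zero)
  length-edgesFrom k G u = begin
    length (edgesFrom k G u)                       ≤⟨ length-concatMap-≤ (edgesBetween k G u) atMostOne (allFin _) ⟩
    length (allFin (width G (suc zero))) * 1       ≡⟨ *-identityʳ _ ⟩
    length (allFin (width G (suc zero)))           ≡⟨ length-tabulate _ ⟩
    width G (suc zero)                             ∎
    where
    open ≤-Reasoning
    atMostOne : ∀ v → length (edgesBetween k G u v) ≤ 1
    atMostOne v with edge G zero u v
    ... | just _  = s≤s z≤n
    ... | nothing = z≤n

  length-edges : ∀ {ℓ} k (G : Layered A n ℓ) → length (edges k G) ≤ vertices G * vertices G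
  length-edges {zero}  k G = z≤n
  length-edges {suc ℓ} k G = begin
    length (edges k G)
      ≡⟨ length-++ (concatMap (edgesFrom k G) (allFin _)) ⟩
    length (concatMap (edgesFrom k G) (allFin _)) + length (edges (suc k) (dropLayer G))
      ≤⟨ +-mono-≤ (length-concatMap-≤ (edgesFrom k G) (length-edgesFrom k G) (allFin _)) (length-edges (suc k) (dropLayer G)) ⟩
    length (allFin w) * width G (suc zero) + t * t
      ≡⟨ cong (λ m → m * width G (suc zero) + t * t) (length-tabulate {n = w} id) ⟩
    w * width G (suc zero) + t * t
      -- The next width is a summand of `t`. The slack added here makes both terms multiples of
      -- `w + t`.
      ≤⟨ +-mono-≤ (*-monoʳ-≤ w (≤-trans (m≤m+n _ _) (m≤n+m t w))) (*-monoˡ-≤ t (m≤n+m t w))  ⟩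
    w * (w + t) + (w + t) * t
      ≡⟨ cong (w * (w + t) +_) (*-comm (w + t) t) ⟩
    w * (w + t) + t * (w + t)
      ≡⟨ *-distribʳ-+ (w + t) w t ⟨
    (w + t) * (w + t) ∎
    where
    open ≤-Reasoning
    w t : ℕ
    w = width G zero
    t = vertices (dropLayer G)

  -- Following outgoing edges from the given vertex shows that no layer is empty.
  depth≤vertices : ∀ {ℓ} (G : Layered A n ℓ) → NoDeadEnds G → Fin (width G zero) → ℓ ≤ vertices G
  depth≤vertices {zero}  G out u = z≤n
  depth≤vertices {suc ℓ} G out u = +-mono-≤ (≤-trans (s≤s z≤n) (toℕ<n u))
    (depth≤vertices (dropLayer G) (out ∘ suc) (proj₁ (out zero u)))

-- The simulating program

module Simulation {c ℓ₁ ℓ₂} {F : HeytingField c ℓ₁ ℓ₂} {n : ℕ}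
  (es : List (Edge (HeytingField.Carrier F) n)) (final? : Vertex → Bool) (s : Vertex) where

  open CommutativeSemiring (fieldSemiring F) using (Carrier; 0#; 1#)
  open Polynomials (fieldSemiring F) n
  open PolynomialProperties (fieldSemiring F) n
  module ≋-Reasoning = Relation.Binary.Reasoning.Setoid ≋-setoid

  private
    infixr 6 _▷_
    _▷_ : Label Carrier n → Polynomial → Polynomial
    _▷_ = _▸_ {F = F}

  fires? : (b : Maybe (Fin n)) (e : Edge Carrier n) → Dec (letter (label e) ≡ b)
  fires? b e = letter (label e) ≟ₗ b

  -- reading σ e is the sum over the continuations of e whose letters are read
  -- greedily along σ, and arrival σ v is the same sum for all paths leaving v.
  reading : List (Maybe (Fin n)) → Edge Carrier n → Polynomial
  arrival : List (Maybe (Fin n)) → Vertex → Polynomial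

  reading []      e = []
  reading (b ∷ σ) e = if does (fires? b e) then label e ▷ arrival σ (tgt e) else reading σ e

  arrival σ v = (if final? v then constₚ 1# else []) ++ concatMap (reading σ) (outgoing es v)

  -- A state is an edge waiting to be read, or one of three others: done has
  -- reached the sink, while idle and dead have only edges labelled 0 and give
  -- every state an incoming and an outgoing edge. Merging these two would allow
  -- a path to pass through the merged state and read a variable again.
  states : ℕ
  states = 3 + length es

  pattern idle  = zero
  pattern dead  = suc zero
  pattern done  = suc (suc zero)
  pattern at i  = suc (suc (suc i))

  when : Bool → Label Carrier n → Maybe (Label Carrier n)
  when t l = if t then just l else nothing

  -- Used next to the source and the sink, where a state has only one possible neighbour: a missing
  -- edge would violate `has-in-edge` or `has-out-edge`, so an edge labelled 0 replaces it.
  orZero : Bool → Label Carrier n → Maybe (Label Carrier n)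
  orZero t l = just (if t then l else const 0#)

  enter : Fin 1 → Fin states → Maybe (Label Carrier n)
  enter _ idle   = just (const 0#)
  enter _ dead   = just (const 0#)
  enter _ done   = orZero (final? s) (const 1#)
  enter _ (at i) = orZero (does (src (lookup es i) ≟ᵥ s)) (const 1#)

  -- The flag says whether the edge fires. A firing edge has to be traversed and any other has to
  -- wait, up to the edge labelled 0 into `dead`; this is the greedy rule.
  advance : Bool → Fin (length es) → Fin states → Maybe (Label Carrier n)
  advance _     i idle   = nothing
  advance _     i dead   = just (const 0#)
  advance true  i done   = when (final? (tgt (lookup es i))) (label (lookup es i))
  advance true  i (at j) = when (does (src (lookup es j) ≟ᵥ tgt (lookup es i))) (label (lookup es i))
  advance false i done   = nothing
  advance false i (at j) = when (does (j Fin.≟ i)) (const 1#)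

  move : Maybe (Fin n) → Fin states → Fin states → Maybe (Label Carrier n)
  move b idle   _    = just (const 0#)
  move b dead   dead = just (const 0#)
  move b dead   _    = nothing
  move b done   done = just (const 1#)
  move b done   _    = nothing
  move b (at i) y    = advance (does (fires? b (lookup es i))) i y

  leave : Maybe (Fin n) → Fin states → Fin 1 → Maybe (Label Carrier n)
  leave b idle   _ = just (const 0#)
  leave b dead   _ = just (const 0#)
  leave b done   _ = just (const 1#)
  leave b (at i) _ = orZero (does (fires? b (lookup es i)) ∧ final? (tgt (lookup es i))) (label (lookup es i))

  bodyWidth : (σ : List (Maybe (Fin n))) → Fin (2 + length σ) → ℕ
  bodyWidth σ       zero    = states
  bodyWidth []      (suc _) = 1
  bodyWidth (_ ∷ σ) (suc i) = bodyWidth σ i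

  -- The letters read are `b ∷ σ`, a nonempty list, so that there is a last letter to be read on the
  -- edges into the sink.
  bodyEdge : ∀ b σ (i : Fin (suc (length σ))) →
    Fin (bodyWidth σ (inject₁ i)) → Fin (bodyWidth σ (suc i)) → Maybe (Label Carrier n)
  bodyEdge b []      zero    = leave b
  bodyEdge b (_ ∷ σ) zero    = move b
  bodyEdge b (d ∷ σ) (suc i) = bodyEdge d σ i

  body : (b : Maybe (Fin n)) (σ : List (Maybe (Fin n))) → Layered Carrier n (suc (length σ))
  body b σ .width = bodyWidth σ
  body b σ .edge  = bodyEdge b σ

  programWidth : (σ : List (Maybe (Fin n))) → Fin (3 + length σ) → ℕ
  programWidth σ zero    = 1
  programWidth σ (suc i) = bodyWidth σ i

  programEdge : ∀ b σ (i : Fin (2 + length σ)) →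
    Fin (programWidth σ (inject₁ i)) → Fin (programWidth σ (suc i)) → Maybe (Label Carrier n)
  programEdge b σ zero    = enter
  programEdge b σ (suc i) = bodyEdge b σ i

  along : Maybe (Label Carrier n) → Polynomial → Polynomial
  along e p = maybe (λ l → l ▷ p) [] e

  -- What `value` amounts to at each state when `σ` is still to be read; `idle` and `dead` vanish
  -- because their edges are labelled 0.
  stateValue : List (Maybe (Fin n)) → Fin states → Polynomial
  stateValue σ idle   = []
  stateValue σ dead   = []
  stateValue σ done   = constₚ 1#
  stateValue σ (at i) = reading σ (lookup es i)

  concatMap-states : (f : Fin states → Polynomial) →
    concatMap f (allFin states) ≡ f idle ++ f dead ++ f done ++ concatMap (λ i → f (at i)) (allFin (length es))
  concatMap-states f = cong (λ p → f idle ++ f dead ++ f done ++ p) (concatMap-tabulate f (λ i → at i))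

  private
    const0-▷ : ∀ p → const 0# ▷ p ≋ []
    const0-▷ = const0-*
    const1-▷ : ∀ p → const 1# ▷ p ≋ p
    const1-▷ = const1-*

  concatMap-[] : ∀ {a} {A : Set a} (xs : List A) {f : A → Polynomial} → (∀ x → f x ≋ []) → concatMap f xs ≋ []
  concatMap-[] []       f≋0 = ≋-refl
  concatMap-[] (x ∷ xs) f≋0 = +ₚ-cong (f≋0 x) (concatMap-[] xs f≋0)

  concatMap-outgoing : (f : Edge Carrier n → Polynomial) → ∀ v →
    concatMap f (outgoing es v) ≡
    concatMap (λ i → if does (src (lookup es i) ≟ᵥ v) then f (lookup es i) else []) (allFin (length es))
  concatMap-outgoing f v = trans (concatMap-filter (λ e → src e ≟ᵥ v) f es) (concatMap-lookup _ es)

  when-▷ : ∀ t l {p q} → p ≋ q → along (when t l) p ≋ (if t then l ▷ q else [])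
  when-▷ true  l eq = ▸-cong {F = F} l eq
  when-▷ false l eq = ≋-refl

  orZero-▷ : ∀ t l {p q} → p ≋ q → along (orZero t l) p ≋ (if t then l ▷ q else [])
  orZero-▷ true  l         eq = ▸-cong {F = F} l eq
  orZero-▷ false l {p = p} eq = const0-▷ p

  ▷-arrival : ∀ l σ v → l ▷ arrival σ v ≡
    (if final? v then l ▷ constₚ 1# else []) ++
    concatMap (λ i → if does (src (lookup es i) ≟ᵥ v) then l ▷ reading σ (lookup es i) else []) (allFin (length es))
  ▷-arrival l σ v = trans (▸-++ {F = F} l (if final? v then constₚ 1# else []) _)
    (cong₂ _++_ (l▷if (final? v))
      (trans (▸-concatMap {F = F} l (reading σ) (outgoing es v)) (concatMap-outgoing (λ e → l ▷ reading σ e) v)))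
    where
    l▷if : ∀ t → l ▷ (if t then constₚ 1# else []) ≡ (if t then l ▷ constₚ 1# else [])
    l▷if true  = refl
    l▷if false = ▸-[] {F = F} l

  module _ (σ : List (Maybe (Fin n))) (V : Fin states → Polynomial) (V≋ : ∀ x → V x ≋ stateValue σ x) where

    -- `V` stands for the values in the next layer. Firing sums over all guesses of the next edge,
    -- which gives `arrival` at the target; waiting leaves the single term of the same edge.
    advance-value : ∀ t i → concatMap (λ y → along (advance t i y) (V y)) (allFin states) ≋
      (if t then label (lookup es i) ▷ arrival σ (tgt (lookup es i)) else reading σ (lookup es i))
    advance-value true  i = begin
      concatMap (λ y → along (advance true i y) (V y)) (allFin states)
        ≡⟨ concatMap-states (λ y → along (advance true i y) (V y)) ⟩
      const 0# ▷ V dead ++ along (when (final? v) l) (V done) ++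
      concatMap (λ j → along (when (does (src (lookup es j) ≟ᵥ v)) l) (V (at j))) (allFin _)
        ≈⟨ +ₚ-cong (const0-▷ (V dead)) (+ₚ-cong (when-▷ (final? v) l (V≋ done))
             (concatMap-cong-≋ (λ j → when-▷ (does (src (lookup es j) ≟ᵥ v)) l (V≋ (at j))) (allFin _))) ⟩
      (if final? v then l ▷ constₚ 1# else []) ++
      concatMap (λ j → if does (src (lookup es j) ≟ᵥ v) then l ▷ reading σ (lookup es j) else []) (allFin _)
        ≡⟨ ▷-arrival l σ v ⟨
      l ▷ arrival σ v ∎
      where
      open ≋-Reasoning
      l : Label Carrier n
      l = label (lookup es i)
      v : Vertex
      v = tgt (lookup es i)
    advance-value false i = begin
      concatMap (λ y → along (advance false i y) (V y)) (allFin states)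
        ≡⟨ concatMap-states (λ y → along (advance false i y) (V y)) ⟩
      const 0# ▷ V dead ++ concatMap (λ j → along (when (does (j Fin.≟ i)) (const 1#)) (V (at j))) (allFin _)
        ≈⟨ +ₚ-cong (const0-▷ (V dead))
             (concatMap-cong-≋ (λ j → when-▷ (does (j Fin.≟ i)) (const 1#) (V≋ (at j))) (allFin _)) ⟩
      concatMap (λ j → if does (j Fin.≟ i) then const 1# ▷ reading σ (lookup es j) else []) (allFin _)
        ≡⟨ concatMap-only (Fin._≟ i) (λ j → const 1# ▷ reading σ (lookup es j)) i refl (λ _ → id) ⟩
      const 1# ▷ reading σ (lookup es i)
        ≈⟨ const1-▷ (reading σ (lookup es i)) ⟩
      reading σ (lookup es i) ∎
      where open ≋-Reasoning

    move-value : ∀ b x → concatMap (λ y → along (move b x y) (V y)) (allFin states) ≋ stateValue (b ∷ σ) x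
    move-value b idle   = concatMap-[] (allFin states) (λ y → const0-▷ (V y))
    move-value b dead   = ≋-trans (≋-reflexive (concatMap-states (λ y → along (move b dead y) (V y))))
      (+ₚ-cong (const0-▷ (V dead)) (concatMap-[] (allFin (length es)) (λ _ → ≋-refl)))
    move-value b done   = ≋-trans (≋-reflexive (concatMap-states (λ y → along (move b done y) (V y))))
      (+ₚ-cong (≋-trans (const1-▷ (V done)) (V≋ done)) (concatMap-[] (allFin (length es)) (λ _ → ≋-refl)))
    move-value b (at i) = advance-value (does (fires? b (lookup es i))) i

  -- The trailing `++ []` comes from the sum over the one vertex of the last layer.
  leave-value : ∀ b x → along (leave b x zero) (constₚ 1#) ++ [] ≋ stateValue (b ∷ []) x
  leave-value b x = ≋-trans (≋-reflexive (++-identityʳ _)) (row x)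
    where
    row : ∀ x → along (leave b x zero) (constₚ 1#) ≋ stateValue (b ∷ []) x
    row idle   = const0-▷ (constₚ 1#)
    row dead   = const0-▷ (constₚ 1#)
    row done   = const1-▷ (constₚ 1#)
    row (at i) with does (fires? b (lookup es i))
    ... | false = const0-▷ (constₚ 1#)
    -- No letter remains after this one, so every guessed next edge contributes nothing and
    -- `arrival` reduces to the test `final?`.
    ... | true  = ≋-trans (orZero-▷ (final? (tgt (lookup es i))) (label (lookup es i)) ≋-refl)
      (≋-trans (≋-reflexive (sym (++-identityʳ _))) (≋-trans
        (+ₚ-cong ≋-refl (≋-sym (concatMap-[] (allFin (length es)) λ j → if-[] (does (src (lookup es j) ≟ᵥ tgt (lookup es i))))))
        (≋-reflexive (sym (▷-arrival (label (lookup es i)) [] (tgt (lookup es i)))))))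
      where
      if-[] : ∀ t → (if t then label (lookup es i) ▷ [] else []) ≋ []
      if-[] true  = ≋-reflexive (▸-[] {F = F} (label (lookup es i)))
      if-[] false = ≋-refl

  body-value : ∀ b σ x → value {F = F} (body b σ) x ≋ stateValue (b ∷ σ) x
  body-value b []      x = leave-value b x
  body-value b (d ∷ σ) x = move-value (d ∷ σ) (value {F = F} (body d σ)) (body-value d σ) b x

  program : Maybe (Fin n) → (σ : List (Maybe (Fin n))) → Layered Carrier n (2 + length σ)
  program b σ .width = programWidth σ
  program b σ .edge  = programEdge b σ

  program-value : ∀ b σ → value {F = F} (program b σ) zero ≋ arrival (b ∷ σ) s
  program-value b σ = ≋-trans (≋-reflexive (concatMap-states (λ x → along (enter zero x) (value {F = F} (body b σ) x)))) (≋-trans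
    (+ₚ-cong (const0-▷ (value {F = F} (body b σ) idle)) (+ₚ-cong (const0-▷ (value {F = F} (body b σ) dead)) (+ₚ-cong
      (≋-trans (orZero-▷ (final? s) (const 1#) (body-value b σ done)) (if-const1 (final? s) (constₚ 1#)))
      (concatMap-cong-≋ (λ i → ≋-trans (orZero-▷ (does (src (lookup es i) ≟ᵥ s)) (const 1#) (body-value b σ (at i)))
                                       (if-const1 (does (src (lookup es i) ≟ᵥ s)) (reading (b ∷ σ) (lookup es i)))) (allFin _)))))
    (≋-reflexive (cong (_ ++_) (sym (concatMap-outgoing (reading (b ∷ σ)) s)))))
    where
    if-const1 : ∀ t p → (if t then const 1# ▷ p else []) ≋ (if t then p else [])
    if-const1 true  p = const1-▷ p
    if-const1 false p = ≋-refl

  when⁻ : ∀ t {l l′} → when t l ≡ just l′ → l ≡ l′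
  when⁻ true refl = refl

  body-in : ∀ b σ i (y : Fin (bodyWidth σ (suc i))) → ∃₂ λ x l → bodyEdge b σ i x y ≡ just l
  body-in b []      zero    y = idle , _ , refl
  body-in b (_ ∷ σ) zero    y = idle , _ , refl
  body-in b (d ∷ σ) (suc i) y = body-in d σ i y

  leave-out : ∀ b x → ∃₂ λ y l → leave b x y ≡ just l
  leave-out b idle   = zero , _ , refl
  leave-out b dead   = zero , _ , refl
  leave-out b done   = zero , _ , refl
  leave-out b (at i) = zero , _ , refl

  move-out : ∀ b x → ∃₂ λ y l → move b x y ≡ just l
  move-out b idle   = dead , _ , refl
  move-out b dead   = dead , _ , refl
  move-out b done   = done , _ , refl
  move-out b (at i) = dead , _ , refl

  body-out : ∀ b σ i (x : Fin (bodyWidth σ (inject₁ i))) → ∃₂ λ y l → bodyEdge b σ i x y ≡ just l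
  body-out b []      zero    x = leave-out b x
  body-out b (_ ∷ σ) zero    x = move-out b x
  body-out b (d ∷ σ) (suc i) x = body-out d σ i x

  enter-in : ∀ x → ∃₂ λ u l → enter u x ≡ just l
  enter-in idle   = zero , _ , refl
  enter-in dead   = zero , _ , refl
  enter-in done   = zero , _ , refl
  enter-in (at i) = zero , _ , refl

  body-sink : ∀ σ → ∃ λ (t : Fin (bodyWidth σ (fromℕ (suc (length σ))))) → ∀ u → u ≡ t
  body-sink []      = zero , λ { zero → refl }
  body-sink (_ ∷ σ) = body-sink σ

  simulate : Maybe (Fin n) → List (Maybe (Fin n)) → ABP F n
  simulate b σ = record
    { depth         = 2 + length σ
    ; graph         = program b σ
    ; source        = zero
    ; source-unique = λ { zero → refl }
    ; sink          = proj₁ (body-sink σ)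
    ; sink-unique   = proj₂ (body-sink σ)
    ; has-in-edge   = λ { zero x → enter-in x ; (suc i) y → body-in b σ i y }
    ; has-out-edge  = λ { zero _ → idle , _ , refl ; (suc i) x → body-out b σ i x }
    }

  enter-readsOnly : ∀ u x {l} → enter u x ≡ just l → ReadsOnly nothing l
  enter-readsOnly _ idle   refl = inj₂ (_ , refl)
  enter-readsOnly _ dead   refl = inj₂ (_ , refl)
  enter-readsOnly _ done   refl with final? s
  ... | true  = inj₂ (_ , refl)
  ... | false = inj₂ (_ , refl)
  enter-readsOnly _ (at i) refl with does (src (lookup es i) ≟ᵥ s)
  ... | true  = inj₂ (_ , refl)
  ... | false = inj₂ (_ , refl)

  move-readsOnly : ∀ b x y {l} → move b x y ≡ just l → ReadsOnly b l
  move-readsOnly b idle   y      refl = inj₂ (_ , refl)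
  move-readsOnly b dead   dead   refl = inj₂ (_ , refl)
  move-readsOnly b done   done   refl = inj₂ (_ , refl)
  move-readsOnly b (at i) dead   refl = inj₂ (_ , refl)
  move-readsOnly b (at i) done   eq with fires? b (lookup es i)
  ... | yes f with refl ← when⁻ (final? (tgt (lookup es i))) eq = letter⇒readsOnly _ f
  move-readsOnly b (at i) (at j) eq with fires? b (lookup es i)
  ... | yes f with refl ← when⁻ (does (src (lookup es j) ≟ᵥ tgt (lookup es i))) eq = letter⇒readsOnly _ f
  ... | no _  with refl ← when⁻ (does (j Fin.≟ i)) eq = inj₂ (_ , refl)

  leave-readsOnly : ∀ b x y {l} → leave b x y ≡ just l → ReadsOnly b l
  leave-readsOnly b idle   _ refl = inj₂ (_ , refl)
  leave-readsOnly b dead   _ refl = inj₂ (_ , refl)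
  leave-readsOnly b done   _ refl = inj₂ (_ , refl)
  leave-readsOnly b (at i) _ refl with fires? b (lookup es i) | final? (tgt (lookup es i))
  ... | yes f | true  = letter⇒readsOnly _ f
  ... | yes f | false = inj₂ (_ , refl)
  ... | no _  | _     = inj₂ (_ , refl)

  body-readsOnly : ∀ b σ i x y {l} → bodyEdge b σ i x y ≡ just l → ReadsOnly (lookup (b ∷ σ) i) l
  body-readsOnly b []      zero    = leave-readsOnly b
  body-readsOnly b (_ ∷ σ) zero    = move-readsOnly b
  body-readsOnly b (d ∷ σ) (suc i) = body-readsOnly d σ i

  simulate-readsOnly : ∀ b σ i x y l → programEdge b σ i x y ≡ just l → ReadsOnly (lookup (nothing ∷ b ∷ σ) i) l
  simulate-readsOnly b σ zero    x y l = enter-readsOnly x y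
  simulate-readsOnly b σ (suc i) x y l = body-readsOnly b σ i x y

  -- Invariant for the variables `w` on the rest of a path from a state. They come from one
  -- contiguous walk because `idle` can be visited only before anything is read, and nothing is read
  -- from `dead` or `done` on. At `idle` the start of the walk is left open, since any state may
  -- follow.
  Tracks : Fin states → List (Fin n) → Set c
  Tracks idle   w = ∃ λ v → Walk es v w
  Tracks dead   w = Walk es s w × w ≡ []
  Tracks done   w = Walk es s w × w ≡ []
  Tracks (at i) w = Walk es (src (lookup es i)) w

  tracks⇒walk : ∀ x {w} → Tracks x w → ∃ λ v → Walk es v w
  tracks⇒walk idle   t       = t
  tracks⇒walk dead   (t , _) = _ , t
  tracks⇒walk done   (t , _) = _ , t
  tracks⇒walk (at i) t       = _ , t

  move-tracks : ∀ b x y {l w} → move b x y ≡ just l → Tracks y w → Tracks x (l ▹ w)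
  move-tracks b idle   y      refl t          = tracks⇒walk y t
  move-tracks b dead   dead   refl t          = t
  move-tracks b done   done   refl t          = t
  move-tracks b (at i) dead   refl (_ , refl) = []
  move-tracks b (at i) done   eq   (_ , refl) with fires? b (lookup es i)
  ... | yes _ with refl ← when⁻ (final? (tgt (lookup es i))) eq = ∈-lookup i ∷ []
  move-tracks b (at i) (at j) eq   t          with fires? b (lookup es i)
  ... | no _ with j Fin.≟ i | eq
  ...   | yes refl | refl = t
  move-tracks b (at i) (at j) {w = w} eq t | yes _ with src (lookup es j) ≟ᵥ tgt (lookup es i) | eq
  ...   | yes adj | refl = ∈-lookup i ∷ subst (λ v → Walk es v w) adj t

  leave-tracks : ∀ b x y {l} → leave b x y ≡ just l → Tracks x (l ▹ [])
  leave-tracks b idle   _ refl = s , []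
  leave-tracks b dead   _ refl = [] , refl
  leave-tracks b done   _ refl = [] , refl
  leave-tracks b (at i) _ refl with does (fires? b (lookup es i)) ∧ final? (tgt (lookup es i))
  ... | true  = ∈-lookup i ∷ []
  ... | false = []

  body-tracks : ∀ b σ x (ρ : Path (body b σ) x) → Tracks x (vars (labels ρ))
  body-tracks b []      x (step y l eq end) = leave-tracks b x y eq
  body-tracks b (d ∷ σ) x (step y l eq ρ)   = move-tracks b x y eq (body-tracks d σ y ρ)

  simulate-walk : ∀ b σ (ρ : Path (program b σ) zero) → ∃ λ v → Walk es v (vars (labels ρ))
  simulate-walk b σ (step x l eq ρ) with enter-readsOnly zero x eq
  ... | inj₂ (_ , refl) = tracks⇒walk x (body-tracks b σ x ρ)

  size-simulate : ∀ b σ → size (simulate b σ) ≡ 2 + suc (length σ) * states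
  size-simulate b σ = cong suc (bodySize σ)
    where
    bodySize : ∀ σ → sum (tabulate (bodyWidth σ)) ≡ 1 + suc (length σ) * states
    bodySize []      = trans (+-comm states 1) (cong suc (sym (+-identityʳ states)))
    bodySize (_ ∷ σ) = trans (cong (states +_) (bodySize σ)) (+-suc states _)

-- Correctness of greedy reading

module _ {c ℓ₁ ℓ₂} {F : HeytingField c ℓ₁ ℓ₂} {n : ℕ}
  (es : List (Edge (HeytingField.Carrier F) n)) (d : ℕ) (s : Vertex) where

  open CommutativeSemiring (fieldSemiring F) using (Carrier; 0#; 1#)
  open Polynomials (fieldSemiring F) n
  open PolynomialProperties (fieldSemiring F) n
  open Simulation {F = F} es (λ v → does (proj₁ v ℕ.≟ d)) s

  -- Greediness loses nothing: if the schedule begins with the letter of `e`, an embedding may as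
  -- well use this occurrence (`∷⁻`); if not, every embedding avoids it (`∷ʳ⁻`). The path `ρ₀`
  -- excludes that the schedule runs out. The premise on `arrival` is supplied by the induction over
  -- layers in `arrival≋`.
  reading≋ : ∀ {ℓ} (G : Layered Carrier n ℓ) u → Path G u → ∀ e →
    (∀ σ → (∀ (ρ : Path G u) → word ρ ⊆ σ) → arrival σ (tgt e) ≋ value {F = F} G u) →
    ∀ σ → (∀ (ρ : Path G u) → letter (label e) ∷ word ρ ⊆ σ) →
    reading σ e ≋ _▸_ {F = F} (label e) (value {F = F} G u)
  reading≋ G u ρ₀ e arr []      reads with () ← reads ρ₀
  reading≋ G u ρ₀ e arr (b ∷ σ) reads with fires? b e
  ... | yes _ = ▸-cong {F = F} (label e) (arr σ (λ ρ → ∷⁻ (reads ρ)))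
  ... | no ¬f = reading≋ G u ρ₀ e arr σ (λ ρ → ∷ʳ⁻ ¬f (reads ρ))

  -- The equation `ℓ + k ≡ d` makes the test for a final vertex succeed exactly in the last layer,
  -- where no edge leaves; elsewhere only the outgoing edges contribute.
  arrival≋ : ∀ {ℓ} k (G : Layered Carrier n ℓ) → ℓ + k ≡ d → AgreesFrom es k G → NoDeadEnds G →
    ∀ u σ → (∀ (ρ : Path G u) → word ρ ⊆ σ) → arrival σ (k , toℕ u) ≋ value {F = F} G u
  arrival≋ {zero} k G refl agrees out u σ reads rewrite dec-true (k ℕ.≟ k) refl =
    ≋-reflexive (cong (λ es′ → constₚ 1# ++ concatMap (reading σ) es′) (agrees (k , toℕ u) ≤-refl))
  arrival≋ {suc ℓ} k G refl agrees out u σ reads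
    rewrite dec-false (k ℕ.≟ suc ℓ + k) (<⇒≢ (m<n+m k (s≤s z≤n))) = begin
    concatMap (reading σ) (outgoing es (k , toℕ u))
      ≡⟨ cong (concatMap (reading σ)) (trans (agrees (k , toℕ u) ≤-refl) (outgoing-head k G u)) ⟩
    concatMap (reading σ) (edgesFrom k G u)
      ≡⟨ concatMap-concatMap (reading σ) (edgesBetween k G u) (allFin _) ⟩
    concatMap (λ v → concatMap (reading σ) (edgesBetween k G u v)) (allFin _)
      ≈⟨ concatMap-cong-≋ branch (allFin _) ⟩
    value {F = F} G u ∎
    where
    open ≋-Reasoning
    branch : ∀ v → concatMap (reading σ) (edgesBetween k G u v) ≋
                   maybe (λ l → _▸_ {F = F} l (value {F = F} (dropLayer G) v)) [] (edge G zero u v)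
    branch v with edge G zero u v in eq
    ... | nothing = ≋-refl
    ... | just l  = ≋-trans (≋-reflexive (++-identityʳ _)) (reading≋ (dropLayer G) v (somePath (dropLayer G) (out ∘ suc) v) _
      (arrival≋ (suc k) (dropLayer G) (+-suc ℓ k) (agreesFrom-dropLayer es G agrees) (out ∘ suc) v) σ
      (λ ρ → reads (step v l eq ρ)))

-- The schedule

module _ {n : ℕ} (π : Permutation′ n) where

  infix 4 _≺_
  _≺_ : Rel (Fin n) _
  x ≺ y = π ⟨$⟩ʳ x Fin.< π ⟨$⟩ʳ y

  -- The tabulation lists all variables by increasing `π`, so filtering it does the work of sorting
  -- and also removes repetitions in `vs`.
  arrange : List (Fin n) → List (Fin n)
  arrange vs = filter (λ x → decMember Fin._≟_ x vs) (tabulate (π ⟨$⟩ˡ_))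

  arrange-sorted : ∀ vs → AllPairs _≺_ (arrange vs)
  arrange-sorted vs = AllPairs.filter⁺ _ (AllPairs.tabulate⁺-< (subst₂ Fin._<_ (sym (inverseʳ π)) (sym (inverseʳ π))))

  arrange-unique : ∀ vs → Unique (arrange vs)
  arrange-unique vs = AllPairs.map (λ { x≺x refl → <-irrefl refl x≺x }) (arrange-sorted vs)

  -- A bound in terms of `vs` instead of `n`; it keeps the number of variables out of the size.
  length-arrange : ∀ vs → length (arrange vs) ≤ length vs
  length-arrange vs = length-unique-≤ (arrange-unique vs)
    (All.tabulate (proj₂ ∘ ∈-filter⁻ (λ x → decMember Fin._≟_ x vs) {xs = tabulate (π ⟨$⟩ˡ_)}))

  ∈-arrange : ∀ {vs x} → x ∈ vs → x ∈ arrange vs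
  ∈-arrange {vs} {x} x∈ = ∈-filter⁺ (λ x → decMember Fin._≟_ x vs) (subst (_∈ tabulate (π ⟨$⟩ˡ_)) (inverseˡ π) (∈-tabulate⁺ (π ⟨$⟩ʳ x))) x∈

  sorted⇒⊆arrange : ∀ {vs xs} → AllPairs _≺_ xs → All (_∈ vs) xs → xs ⊆ arrange vs
  sorted⇒⊆arrange s xs∈ = sorted⇒⊆ (<-irrefl refl) <-trans s (arrange-sorted _) (All.map ∈-arrange xs∈)

module _ {n : ℕ} where

  gap : ℕ → List (Maybe (Fin n))
  gap k = replicate k nothing

  -- Every nothing leaves room for one constant.
  padded : ℕ → ℕ → List (Fin n) → List (Maybe (Fin n))
  padded K k ys = gap k ++ concatMap (λ y → just y ∷ gap K) ys

  length-padded : ∀ K k ys → length (padded K k ys) ≡ k + length ys * suc K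
  length-padded K k ys = trans (length-++ (gap k)) (cong₂ _+_ (length-replicate k) (blocks ys))
    where
    blocks : ∀ ys → length (concatMap (λ y → just y ∷ gap K) ys) ≡ length ys * suc K
    blocks []       = refl
    blocks (y ∷ ys) = cong suc (trans (length-++ (gap K)) (cong₂ _+_ (length-replicate K) (blocks ys)))

  catMaybes-padded : ∀ K k ys → catMaybes (padded K k ys) ≡ ys
  catMaybes-padded K (suc k) ys       = catMaybes-padded K k ys
  catMaybes-padded K zero    []       = refl
  catMaybes-padded K zero    (y ∷ ys) = cong (y ∷_) (catMaybes-padded K K ys)

  module _ {a} {A : Set a} where

    -- `k` is the room left in the current gap and `K` that of a full one. A constant uses up one
    -- place and one label, which preserves `ℓ ≤ k`; moving past a scheduled variable opens a full
    -- gap.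
    ⊆-padded : ∀ K k ys {ℓ} (ls : Vec (Label A n) ℓ) → ℓ ≤ k → k ≤ K → vars ls ⊆ ys →
      map letter (toList ls) ⊆ padded K k ys
    ⊆-padded K k       ys       []             _         _   _ = minimum _
    ⊆-padded K (suc k) ys       (const _ ∷ ls) (s≤s ℓ≤k) k<K s = refl ∷ ⊆-padded K k ys ls ℓ≤k (≤-trans (n≤1+n k) k<K) s
    ⊆-padded K k       (y ∷ ys) (var x ∷ ls)   ℓ<k       k≤K (_ ∷ʳ s) =
      ⊆-++⁺ˡ (gap k) (just y ∷ʳ ⊆-padded K K ys (var x ∷ ls) (≤-trans ℓ<k k≤K) ≤-refl s)
    ⊆-padded K k       (y ∷ ys) (var x ∷ ls)   ℓ<k       k≤K (refl ∷ s) =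
      ⊆-++⁺ˡ (gap k) (refl ∷ ⊆-padded K K ys ls (≤-trans (n≤1+n _) (≤-trans ℓ<k k≤K)) ≤-refl s)

-- (3 + S²) (1 + L (2 + S + S² (1 + S)))
sizeBound : ℕ[ 2 ]
sizeBound = (3 , 0 ∷ 0 ∷ []) ∷ (6 , 1 ∷ 0 ∷ []) ∷ (3 , 1 ∷ 1 ∷ []) ∷ (5 , 1 ∷ 2 ∷ []) ∷ (4 , 1 ∷ 3 ∷ [])
          ∷ (1 , 0 ∷ 2 ∷ []) ∷ (1 , 1 ∷ 4 ∷ []) ∷ (1 , 1 ∷ 5 ∷ []) ∷ []

evalℕ-sizeBound : ∀ L S → evalℕ sizeBound (L ∷ S ∷ []) ≡ (1 + L * (2 + (S + (S * S) * suc S))) * (3 + S * S)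
evalℕ-sizeBound = solve 2 (λ L S →
  t 3 L 0 S 0 :+ (t 6 L 1 S 0 :+ (t 3 L 1 S 1 :+ (t 5 L 1 S 2 :+ (t 4 L 1 S 3
    :+ (t 1 L 0 S 2 :+ (t 1 L 1 S 4 :+ (t 1 L 1 S 5 :+ con 0)))))))
  := (con 1 :+ L :* (con 2 :+ (S :+ (S :* S) :* (con 1 :+ S)))) :* (con 3 :+ S :* S)) refl
  where
  open +-*-Solver
  -- The shape to which `evalℕ` unfolds on one term, including the empty product at its end, so that
  -- the solver's equation matches the goal.
  t : ℕ → Polynomial 2 → ℕ → Polynomial 2 → ℕ → Polynomial 2
  t r L i S j = con r :* ((L :^ i) :* ((S :^ j) :* con 1))

-- The program with one pass per order

module _ {c ℓ₁ ℓ₂} {F : HeytingField c ℓ₁ ℓ₂} {n L : ℕ} (P : ABP F n) (ord : Ordered (suc L) P) where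
  open ABP P
  open Ordered ord
  open PolynomialProperties (fieldSemiring F) n

  private
    s : Vertex
    s = 0 , toℕ source

    es : List (Edge (HeytingField.Carrier F) n)
    es = edges 0 graph

    final? : Vertex → Bool
    final? v = does (proj₁ v ℕ.≟ depth)

  open Simulation {F = F} es final? s

  private
    variableOrder : Fin (suc L) → List (Fin n)
    variableOrder j = arrange (order j) (usedVars es)

    pass : Fin (suc L) → List (Maybe (Fin n))
    pass j = padded depth depth (variableOrder j)

    -- The first nothing of the first block belongs to the layer of edges leaving
    -- the source, which read nothing; the second ensures that another layer follows.
    block : Fin (suc L) → List (Maybe (Fin n))
    block j = nothing ∷ nothing ∷ pass j

    -- Chosen so that `join block` is definitionally `nothing ∷ nothing ∷ σ`; the boundaries of the
    -- blocks are then layer indices of the program without any cast.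
    σ : List (Maybe (Fin n))
    σ = pass zero ++ join (block ∘ suc)

    sorted : ∀ (ρ : STPath) → let j = proj₁ (consistent ρ) in AllPairs (_≺_ (order j)) (vars (labels ρ))
    sorted ρ = positions⇒sorted (labels ρ) (proj₂ (consistent ρ))

    path⊆pass : ∀ (ρ : STPath) → word ρ ⊆ pass (proj₁ (consistent ρ))
    path⊆pass ρ = ⊆-padded depth depth _ (labels ρ) ≤-refl ≤-refl
      (sorted⇒⊆arrange (order _) (sorted ρ) (path-usesVars 0 graph ρ ∈-usedVars))

    pass⊆σ : ∀ j → pass j ⊆ nothing ∷ σ
    pass⊆σ zero    = nothing ∷ʳ ⊆-++⁺ʳ (join (block ∘ suc)) ⊆-refl
    pass⊆σ (suc j) = nothing ∷ʳ ⊆-++⁺ˡ (pass zero) (⊆-trans (nothing ∷ʳ nothing ∷ʳ ⊆-refl) (⊆-join (block ∘ suc) j))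

    agrees : AgreesFrom es 0 graph
    agrees v _ = refl

    unique : ∀ u (ρ : Path graph u) → Unique (vars (labels ρ))
    unique u ρ with refl ← source-unique u = AllPairs.map (λ { x≺x refl → <-irrefl refl x≺x }) (sorted ρ)

    walk-unique′ : ∀ {v w} → Walk es v w → Unique w
    walk-unique′ []         = []
    walk-unique′ (e∈ ∷ walk) = walk-unique 0 graph agrees has-out-edge has-in-edge unique refl e∈ (e∈ ∷ walk)

  passProgram : ABP F n
  passProgram = simulate nothing σ

  passProgram-value : value {F = F} (ABP.graph passProgram) zero ≋ value {F = F} graph source
  passProgram-value = ≋-trans (program-value nothing σ)
    (arrival≋ es depth s 0 graph (+-identityʳ depth) agrees has-out-edge source (nothing ∷ σ)
      (λ ρ → ⊆-trans (path⊆pass ρ) (pass⊆σ (proj₁ (consistent ρ)))))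

  passProgram-pass : Pass (suc L) passProgram
  passProgram-pass = record
    { oblivious            = λ i → lookup (join block) i , simulate-readsOnly nothing σ i
    ; syntacticMultilinear = λ ρ → unique⇒positions≡ (labels ρ) (walk-unique′ (proj₂ (simulate-walk nothing σ ρ)))
    ; cut                  = boundary block
    ; cut-first            = refl
    ; cut-last             = boundary-last block
    ; cut-mono             = boundary-mono block
    ; readOnce             = λ j x i i′ r r′ app app′ →
        onceBetween-boundaries block block-unique j x i i′ r r′ (reads i app) (reads i′ app′)
    }
    where
    block-unique : ∀ j → Unique (catMaybes (block j))
    block-unique j = subst Unique (sym (catMaybes-padded depth depth (variableOrder j))) (arrange-unique (order j) (usedVars es))
    reads : ∀ i {x} → AppearsIn passProgram x i → lookup (join block) i ≡ just x
    reads i (u , v , eq) with simulate-readsOnly nothing σ i u v _ eq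
    ... | inj₁ (_ , eq′ , refl) = eq′

  size-passProgram : size passProgram ≤ evalℕ sizeBound (suc L ∷ size P ∷ [])
  size-passProgram = begin
    size passProgram
      ≡⟨ size-simulate nothing σ ⟩
    2 + suc (length σ) * states
      -- The two layers with one vertex are counted as full ones, so that the factor becomes the
      -- number of all layers, `1 + length (join block)`.
      ≤⟨ +-monoˡ-≤ _ (*-mono-≤ {2} {2} ≤-refl (s≤s {0} {2 + length es} z≤n)) ⟩
    2 * states + suc (length σ) * states
      ≡⟨ *-distribʳ-+ states 2 (suc (length σ)) ⟨
    (1 + length (join block)) * states
      ≤⟨ *-mono-≤ (s≤s (length-join block length-block)) (+-monoʳ-≤ 3 (length-edges 0 graph)) ⟩
    (1 + suc L * (2 + (S + (S * S) * suc S))) * (3 + S * S)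
      ≡⟨ evalℕ-sizeBound (suc L) S ⟨
    evalℕ sizeBound (suc L ∷ S ∷ []) ∎
    where
    open ≤-Reasoning
    S : ℕ
    S = size P
    depth≤S : depth ≤ S
    depth≤S = depth≤vertices graph has-out-edge source
    -- The summands are the two extra letters, the leading gap of length `depth`, and at most one
    -- variable per edge, each followed by a gap of that length.
    length-block : ∀ j → length (block j) ≤ 2 + (S + (S * S) * suc S)
    length-block j = +-monoʳ-≤ 2 (≤-trans (≤-reflexive (length-padded depth depth (variableOrder j)))
      (+-mono-≤ depth≤S (*-mono-≤ (≤-trans (length-arrange (order j) (usedVars es))
        (≤-trans (length-mapMaybe (letter ∘ Edge.label) es) (length-edges 0 graph))) (s≤s depth≤S))))

theorem5 : ∀ c ℓ₁ ℓ₂ →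
    ∃ λ (q : ℕ[ 2 ]) →
    (F : HeytingField c ℓ₁ ℓ₂) (n L : ℕ) → 1 ≤ L →
    (P : ABP F n) → Ordered L P →
    (f : F [X n ]) → P Computes f →
    ∃ λ (Q : ABP F n) → Pass L Q × size Q ≤ evalℕ q (L ∷ size P ∷ []) × Q Computes f
theorem5 c ℓ₁ ℓ₂ = sizeBound , λ { F n (suc L) _ P ord f computes →
  let open PolynomialProperties (fieldSemiring F) n in
  passProgram P ord , passProgram-pass P ord , size-passProgram P ord ,
  coeff≈ {q = f} (≋-trans (≋-reflexive (pathSum≡value (ABP.graph (passProgram P ord)) zero))
         (≋-trans (passProgram-value P ord)
         (≋-trans (≋-sym (≋-reflexive (pathSum≡value (ABP.graph P) (ABP.source P)))) (coeffwise computes)))) }
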